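{- For any even integer $k\geq 2$, any $P_k$-design of order $n$ with $n\equiv 0,1\pmod{k-1}$ can be embedded into a $P_k$-design of any order $m>n+1$ with $m\equiv 0,1\pmod{k-1}$.
   Context: $K_n$ is the complete graph on $n$ vertices and $P_k$ is the path with $k$ vertices and $k-1$ edges. For graphs $\Gamma\leq K$ ($\Gamma$ isomorphic to a subgraph of $K$), a $(K,\Gamma)$-design is a set of subgraphs of $K$, each isomorphic to $\Gamma$, whose edge sets partition $E(K)$. A $P_k$-design of order $n$ is a $(K_n,P_k)$-design; in particular $P_k\leq K_n$. A $(K_n,P_k)$-design $\mathcal B$ is embedded into a $(K_m,P_k)$-design $\mathcal B'$ if $V(K_n)\subseteq V(K_m)$ and $\mathcal B\subseteq\mathcal B'$. -}

module Defs where

open import Data.Bool using (Bool; T)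
open import Data.Fin using (Fin; toℕ; inject≤)
open import Data.List using (List)
open import Data.List.Membership.Propositional using (_∈_)
open import Data.Nat using (ℕ; suc; _≤_; ∣_-_∣)
open import Data.Nat.Divisibility using (_∣_)
open import Data.Nat.Properties using (1+n≢n)
open import Data.Product using (Σ; ∃; ∃₂; _×_; _,_; proj₁)
open import Data.Sum using (_⊎_; swap; inj₁; inj₂)
open import Function.Bundles using (_↔_; _⇔_; Inverse)
open import Level using (0ℓ)
open import Relation.Binary.Core using (Rel)
open import Relation.Binary.Definitions using (Symmetric; Irreflexive)
open import Relation.Binary.PropositionalEquality using (_≡_; _≢_; refl; sym)

infix 4 _≡_[mod_] _≅_ _≈_ _≲_

_≡_[mod_] : ℕ → ℕ → ℕ → Set
a ≡ b [mod d ] = d ∣ ∣ a - b ∣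

record Graph : Set₁ where
  field
    V        : Set
    _~_      : Rel V 0ℓ
    ~-sym    : Symmetric _~_
    ~-irrefl : Irreflexive _≡_ _~_

record _≅_ (G H : Graph) : Set where
  private
    module G = Graph G
    module H = Graph H
  field
    bijection : G.V ↔ H.V
    adjacency : ∀ x y → x G.~ y ⇔ Inverse.to bijection x H.~ Inverse.to bijection y

-- Vertex and edge sets of subgraphs are Boolean-valued, so membership is
-- decidable and proofs of membership are unique.
record Subgraph (K : Graph) : Set where
  open Graph K
  field
    vertex    : V → Bool
    edge      : V → V → Bool
    edge-sym  : ∀ {x y} → T (edge x y) → T (edge y x)
    edge⊆     : ∀ {x y} → T (edge x y) → x ~ y
    endpoint  : ∀ {x y} → T (edge x y) → T (vertex x)

toGraph : ∀ {K} → Subgraph K → Graph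
toGraph {K} H = record
  { V        = Σ (Graph.V K) (λ x → T (vertex x))
  ; _~_      = λ u v → T (edge (proj₁ u) (proj₁ v))
  ; ~-sym    = edge-sym
  ; ~-irrefl = λ { refl e → Graph.~-irrefl K refl (edge⊆ e) }
  }
  where open Subgraph H

-- Equality of subgraphs: same vertex set and same edge set.
_≈_ : ∀ {K} → Rel (Subgraph K) 0ℓ
H ≈ H′ = (∀ x → Subgraph.vertex H x ≡ Subgraph.vertex H′ x)
       × (∀ x y → Subgraph.edge H x y ≡ Subgraph.edge H′ x y)

-- Γ is isomorphic to a subgraph of K; the subgraph need not be induced.
_≲_ : Graph → Graph → Set
Γ ≲ K = ∃ λ (H : Subgraph K) → toGraph H ≅ Γ

-- A finite set of subgraphs is represented by a list, read up to _≈_, so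
-- order and repetitions are immaterial: distinctness of blocks always
-- means distinctness up to _≈_.  That the blocks' edges are edges of K is
-- part of Subgraph.
record Design (K Γ : Graph) : Set where
  open Graph K
  field
    Γ≲K      : Γ ≲ K
    blocks   : List (Subgraph K)
    copies   : ∀ {H} → H ∈ blocks → toGraph H ≅ Γ
    covered  : ∀ {x y} → x ~ y → ∃ λ H → H ∈ blocks × T (Subgraph.edge H x y)
    disjoint : ∀ {H H′ x y} → H ∈ blocks → H′ ∈ blocks →
               T (Subgraph.edge H x y) → T (Subgraph.edge H′ x y) → H ≈ H′

complete : ℕ → Graph
complete n = record
  { V        = Fin n
  ; _~_      = _≢_
  ; ~-sym    = λ x≢y y≡x → x≢y (sym y≡x)
  ; ~-irrefl = λ x≡y x≢y → x≢y x≡y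
  }

path : ℕ → Graph
path k = record
  { V        = Fin k
  ; _~_      = λ i j → toℕ j ≡ suc (toℕ i) ⊎ toℕ i ≡ suc (toℕ j)
  ; ~-sym    = swap
  ; ~-irrefl = λ { refl (inj₁ e) → 1+n≢n (sym e) ; refl (inj₂ e) → 1+n≢n (sym e) }
  }

PathDesign : ℕ → ℕ → Set
PathDesign k n = Design (complete n) (path k)

-- H′ is H, viewed as a subgraph of K along the vertex map ι.
IsImage : ∀ {G K} → (Graph.V G → Graph.V K) → Subgraph G → Subgraph K → Set
IsImage ι H H′ =
    (∀ y → T (Subgraph.vertex H′ y) ⇔
       (∃ λ x → ι x ≡ y × T (Subgraph.vertex H x)))
  × (∀ y y′ → T (Subgraph.edge H′ y y′) ⇔
       (∃₂ λ x x′ → ι x ≡ y × ι x′ ≡ y′ × T (Subgraph.edge H x x′)))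

-- The vertices of complete n are 0, …, n - 1, so the inclusion of vertex
-- sets amounts to n ≤ m, with inclusion map inject≤.
EmbeddedInto : ∀ {k n m} → PathDesign k n → PathDesign k m → Set
EmbeddedInto {n = n} {m} 𝓑 𝓑′ =
  Σ (n ≤ m) λ n≤m →
    ∀ {H} → H ∈ Design.blocks 𝓑 →
    ∃ λ H′ → H′ ∈ Design.blocks 𝓑′
           × IsImage {complete n} {complete m} (λ x → inject≤ x n≤m) H H′

{-# OPTIONS --safe #-}
module Submission where

-- Put d = k - 1 = 2 r + 1.  A design of order n is enlarged to order n + s by
-- decomposing K_s together with the complete bipartite graph between the s new
-- and the n old vertices.  Every m is reached by steps s = d, possibly followed
-- by one step s = d + 1 from n ≡ 0 or s = d - 1 from n ≡ 1:
--   * s = d, n ≡ 1: Walecki's Hamiltonian paths of K_{d+1} on the new vertices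
--     and one old vertex, and copies of K_{d,d};
--   * s = d, n ≡ 0: moreover one K_{d,d-1};
--   * s = d + 1, n ≡ 0: Hamiltonian paths of K_{d+1} on the new vertices, and
--     copies of K_{d+1,d};
--   * s = d - 1, n ≡ 1: copies of K_{d-1,d}, and K_{d-1} joined to d + 1 old
--     vertices, where the Hamiltonian paths of K_{d-1} gain an edge at each end.
-- K_{d,d} is a union of zigzags modulo d.  The paths of K_{2b,d} start at one
-- fixed row vertex and then alternate between r consecutive ones of the other
-- 2 r row vertices and cyclically advancing column vertices.

open import Data.Bool using (Bool; true; false; T; T?)
open import Data.Bool.Properties using (T-irrelevant)
open import Data.Empty using (⊥)
open import Data.Fin using (Fin; zero; suc; toℕ; fromℕ<; inject≤; _↑ˡ_; _↑ʳ_; splitAt; join; _≟_)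
open import Data.Fin.Properties using
  (toℕ-injective; toℕ-fromℕ<; toℕ<n; toℕ≤pred[n]; toℕ-↑ˡ; toℕ-↑ʳ; toℕ-inject≤;
   inject≤-idempotent; splitAt-↑ˡ; splitAt-↑ʳ; splitAt-join; join-splitAt; suc-injective;
   any?; injective⇒≤; +↔⊎; *↔×)
open import Data.List using (List; map; concatMap; allFin; _++_)
open import Data.List.Membership.Propositional using (_∈_)
open import Data.List.Membership.Propositional.Properties using
  (∈-map⁺; ∈-map⁻; ∈-++⁺ˡ; ∈-++⁺ʳ; ∈-++⁻; ∈-concat⁺′; ∈-allFin)
open import Data.Nat as ℕ using
  (ℕ; zero; suc; _+_; _*_; _∸_; _≤_; _<_; _≥_; _>_; z≤n; s≤s; NonZero; ⌊_/2⌋; ⌈_/2⌉)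
open import Data.Nat.Divisibility using (_∣_; divides)
open import Data.Nat.DivMod using (_%_; _mod_; %-distribˡ-+; [m+kn]%n≡m%n; m%n%n≡m%n; m<n⇒m%n≡m)
open import Data.Nat.Properties as ℕ using
  (*-cancelʳ-<; *-identityʳ; *-suc; +-assoc; +-comm; +-identityʳ; +-mono-≤; +-monoˡ-<;
   +-suc; <-asym; <⇒≢; <⇒≤; m≤m+n; m≤n+m; m≤n⇒m<n∨m≡n; m≤n⇒∃[o]m+o≡n; n≡⌈n+n/2⌉;
   n≡⌊n+n/2⌋; n≢0⇒n>0; n≤1+n; ∣-∣-identityʳ; ≤-pred; ≤-refl; ≤-trans; ⌊n/2⌋-mono)
open import Data.Nat.Tactic.RingSolver using (solve-∀)
open import Data.Product using (Σ; ∃; ∃₂; _×_; _,_; proj₁; proj₂; uncurry)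
open import Data.Product.Function.NonDependent.Propositional using (_×-↔_)
open import Data.Sum using (_⊎_; inj₁; inj₂; [_,_]; swap)
open import Data.Sum.Function.Propositional using (_⊎-↔_)
open import Data.Sum.Properties using (inj₁-injective; inj₂-injective; swap-involutive)
open import Data.Unit using (⊤; tt)
open import Defs
open import Function using (_∘_; id; Injective)
open import Function.Bundles using (_↔_; _⇔_; mk⇔; mk↔ₛ′; Equivalence; Inverse)
open import Function.Construct.Composition using (_⇔-∘_; _↔-∘_)
open import Function.Properties.Inverse using (↔-refl; ↔-sym; ↔-trans)
open import Relation.Binary.PropositionalEquality using
  (_≡_; _≢_; refl; sym; trans; cong; cong₂; subst; subst₂; module ≡-Reasoning)
open import Relation.Nullary using (¬_; contradiction; Dec)
open import Relation.Nullary.Decidable using (⌊_⌋; toWitness; fromWitness; _×-dec_; _⊎-dec_)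

-- Rotations of ℤ/(n + 1)

abstract
  rotate : ∀ {n} → ℕ → Fin (suc n) → Fin (suc n)
  rotate {n} u x = (toℕ x + u) mod suc n

  toℕ-rotate : ∀ {n} u (x : Fin (suc n)) → toℕ (rotate u x) ≡ (toℕ x + u) % suc n
  toℕ-rotate u x = toℕ-fromℕ< _

%-absorbˡ-+ : ∀ m k d .{{_ : NonZero d}} → (m % d + k) % d ≡ (m + k) % d
%-absorbˡ-+ m k d = begin
  (m % d + k) % d          ≡⟨ %-distribˡ-+ (m % d) k d ⟩
  (m % d % d + k % d) % d  ≡⟨ cong (λ z → (z + k % d) % d) (m%n%n≡m%n m d) ⟩
  (m % d + k % d) % d      ≡⟨ %-distribˡ-+ m k d ⟨
  (m + k) % d              ∎
  where open ≡-Reasoning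

toℕ-rotate-< : ∀ {n} u (x : Fin (suc n)) → toℕ x + u < suc n → toℕ (rotate u x) ≡ toℕ x + u
toℕ-rotate-< u x lt = trans (toℕ-rotate u x) (m<n⇒m%n≡m lt)

rotate-+ : ∀ {n} u v (x : Fin (suc n)) → rotate u (rotate v x) ≡ rotate (v + u) x
rotate-+ {n} u v x = toℕ-injective (begin
  toℕ (rotate u (rotate v x))          ≡⟨ toℕ-rotate u (rotate v x) ⟩
  (toℕ (rotate v x) + u) % suc n       ≡⟨ cong (λ z → (z + u) % suc n) (toℕ-rotate v x) ⟩
  ((toℕ x + v) % suc n + u) % suc n    ≡⟨ %-absorbˡ-+ (toℕ x + v) u (suc n) ⟩
  (toℕ x + v + u) % suc n              ≡⟨ cong (_% suc n) (+-assoc (toℕ x) v u) ⟩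
  (toℕ x + (v + u)) % suc n            ≡⟨ toℕ-rotate (v + u) x ⟨
  toℕ (rotate (v + u) x)               ∎)
  where open ≡-Reasoning

rotate-comm : ∀ {n} u v (x : Fin (suc n)) → rotate u (rotate v x) ≡ rotate v (rotate u x)
rotate-comm u v x = begin
  rotate u (rotate v x)  ≡⟨ rotate-+ u v x ⟩
  rotate (v + u) x       ≡⟨ cong (λ w → rotate w x) (+-comm v u) ⟩
  rotate (u + v) x       ≡⟨ rotate-+ v u x ⟨
  rotate v (rotate u x)  ∎
  where open ≡-Reasoning

rotate-multiple : ∀ {n} q (x : Fin (suc n)) → rotate (q * suc n) x ≡ x
rotate-multiple {n} q x = toℕ-injective (begin
  toℕ (rotate (q * suc n) x)       ≡⟨ toℕ-rotate (q * suc n) x ⟩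
  (toℕ x + q * suc n) % suc n      ≡⟨ [m+kn]%n≡m%n (toℕ x) q (suc n) ⟩
  toℕ x % suc n                    ≡⟨ m<n⇒m%n≡m (toℕ<n x) ⟩
  toℕ x                            ∎)
  where open ≡-Reasoning

rotate-0 : ∀ {n} (x : Fin (suc n)) → rotate 0 x ≡ x
rotate-0 = rotate-multiple 0

-- Rotating by -u is rotating by u (n + 1) - u = u n.
abstract
  unrotate : ∀ {n} → ℕ → Fin (suc n) → Fin (suc n)
  unrotate {n} u = rotate (u * n)

  rotate-unrotate : ∀ {n} u (x : Fin (suc n)) → rotate u (unrotate u x) ≡ x
  rotate-unrotate {n} u x = begin
    rotate u (rotate (u * n) x)  ≡⟨ rotate-+ u (u * n) x ⟩
    rotate (u * n + u) x         ≡⟨ cong (λ w → rotate w x) (trans (+-comm (u * n) u) (sym (*-suc u n))) ⟩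
    rotate (u * suc n) x         ≡⟨ rotate-multiple u x ⟩
    x                            ∎
    where open ≡-Reasoning

  unrotate-rotate : ∀ {n} u (x : Fin (suc n)) → unrotate u (rotate u x) ≡ x
  unrotate-rotate {n} u x = trans (rotate-comm (u * n) u x) (rotate-unrotate u x)

rotate-injective : ∀ {n} u {x y : Fin (suc n)} → rotate u x ≡ rotate u y → x ≡ y
rotate-injective u {x} {y} eq = begin
  x                        ≡⟨ unrotate-rotate u x ⟨
  unrotate u (rotate u x)  ≡⟨ cong (unrotate u) eq ⟩
  unrotate u (rotate u y)  ≡⟨ unrotate-rotate u y ⟩
  y                        ∎
  where open ≡-Reasoning

rotate-from-zero : ∀ {n} u (x : Fin (suc n)) → rotate u x ≡ rotate (toℕ x) (rotate u zero)
rotate-from-zero {n} u x = toℕ-injective (begin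
  toℕ (rotate u x)                          ≡⟨ toℕ-rotate u x ⟩
  (toℕ x + u) % suc n                       ≡⟨ cong (_% suc n) (+-comm (toℕ x) u) ⟩
  (u + toℕ x) % suc n                       ≡⟨ %-absorbˡ-+ u (toℕ x) (suc n) ⟨
  (u % suc n + toℕ x) % suc n               ≡⟨ cong (λ z → (z + toℕ x) % suc n) (toℕ-rotate u zero) ⟨
  (toℕ (rotate u zero) + toℕ x) % suc n     ≡⟨ toℕ-rotate (toℕ x) (rotate u zero) ⟨
  toℕ (rotate (toℕ x) (rotate u zero))      ∎)
  where open ≡-Reasoning

rotate-free : ∀ {n u v} (x : Fin (suc n)) → u ≤ n → v ≤ n → rotate u x ≡ rotate v x → u ≡ v
rotate-free {n} {u} {v} x u≤n v≤n eq = begin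
  u                      ≡⟨ toℕ-rotate-< u zero (s≤s u≤n) ⟨
  toℕ (rotate u (zero {n}))  ≡⟨ cong toℕ (rotate-injective (toℕ x)
                              (trans (sym (rotate-from-zero u x)) (trans eq (rotate-from-zero v x)))) ⟩
  toℕ (rotate v (zero {n}))  ≡⟨ toℕ-rotate-< v zero (s≤s v≤n) ⟩
  v                      ∎
  where open ≡-Reasoning

abstract
  offset : ∀ {n} → Fin (suc n) → Fin (suc n) → ℕ
  offset x y = toℕ (unrotate (toℕ x) y)

  offset≤n : ∀ {n} (x y : Fin (suc n)) → offset x y ≤ n
  offset≤n x y = toℕ≤pred[n] (unrotate (toℕ x) y)

  rotate-offset : ∀ {n} (x y : Fin (suc n)) → rotate (offset x y) x ≡ y
  rotate-offset {n} x y = begin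
    rotate (offset x y) x                         ≡⟨ rotate-from-zero (offset x y) x ⟩
    rotate (toℕ x) (rotate (offset x y) zero)     ≡⟨ cong (rotate (toℕ x)) (toℕ-injective (toℕ-rotate-< (offset x y) zero (s≤s (offset≤n x y)))) ⟩
    rotate (toℕ x) (unrotate (toℕ x) y)           ≡⟨ rotate-unrotate (toℕ x) y ⟩
    y                                             ∎
    where open ≡-Reasoning

offset-unique : ∀ {n u} (x y : Fin (suc n)) → u ≤ n → rotate u x ≡ y → offset x y ≡ u
offset-unique x y u≤n eq = rotate-free x (offset≤n x y) u≤n (trans (rotate-offset x y) (sym eq))

data Halving : ℕ → Set where
  even : ∀ s → Halving (s + s)
  odd  : ∀ s → Halving (suc (s + s))

halving : ∀ u → Halving u
halving zero = even 0
halving (suc u) with halving u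
... | even s = odd s
... | odd s  = subst Halving (cong suc (+-suc s s)) (even (suc s))

⌊double/2⌋ : ∀ s → ⌊ s + s /2⌋ ≡ s
⌊double/2⌋ s = sym (n≡⌊n+n/2⌋ s)

⌈double/2⌉ : ∀ s → ⌈ s + s /2⌉ ≡ s
⌈double/2⌉ s = sym (n≡⌈n+n/2⌉ s)

double-cancel-≤ : ∀ {s t} → s + s ≤ suc (t + t) → s ≤ t
double-cancel-≤ {s} {t} le = subst₂ _≤_ (⌊double/2⌋ s) (⌈double/2⌉ t) (⌊n/2⌋-mono le)

double-cancel-< : ∀ {s t} → s + s < t + t → s < t
double-cancel-< {s} {t} lt = subst₂ _≤_ (cong suc (⌊double/2⌋ s)) (⌈double/2⌉ t) (⌊n/2⌋-mono (s≤s lt))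

double-mono-< : ∀ {s t} → s < t → suc (s + s) < t + t
double-mono-< {s} {t} lt = subst (_≤ t + t) (cong suc (+-suc s s)) (+-mono-≤ lt lt)

alternate : {V : Set} → (ℕ → V) → (ℕ → V) → ℕ → V
alternate α β zero          = α 0
alternate α β (suc zero)    = β 0
alternate α β (suc (suc u)) = alternate (α ∘ suc) (β ∘ suc) u

alternate-even : ∀ {V : Set} (α β : ℕ → V) s → alternate α β (s + s) ≡ α s
alternate-even α β zero    = refl
alternate-even α β (suc s) = trans (cong (λ w → alternate α β (suc w)) (+-suc s s)) (alternate-even (α ∘ suc) (β ∘ suc) s)

alternate-odd : ∀ {V : Set} (α β : ℕ → V) s → alternate α β (suc (s + s)) ≡ β s
alternate-odd α β zero    = refl
alternate-odd α β (suc s) = trans (cong (λ w → alternate α β (suc (suc w))) (+-suc s s)) (alternate-odd (α ∘ suc) (β ∘ suc) s)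

alternate-suc-odd : ∀ {V : Set} (α β : ℕ → V) s → alternate α β (suc (suc (s + s))) ≡ α (suc s)
alternate-suc-odd α β s = alternate-even (α ∘ suc) (β ∘ suc) s

InjectiveUpTo : {V : Set} → ℕ → (ℕ → V) → Set
InjectiveUpTo L w = ∀ {u v} → u ≤ L → v ≤ L → w u ≡ w v → u ≡ v

alternate-injective : ∀ {V : Set} (α β : ℕ → V) L →
  (∀ {s t} → s + s ≤ L → t + t ≤ L → α s ≡ α t → s ≡ t) →
  (∀ {s t} → s + s < L → t + t < L → β s ≡ β t → s ≡ t) →
  (∀ {s t} → s + s ≤ L → t + t < L → α s ≢ β t) →
  InjectiveUpTo L (alternate α β)
alternate-injective α β L α-inj β-inj α≢β {u} {v} u≤L v≤L eq with halving u | halving v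
... | even s | even t =
  cong (λ w → w + w) (α-inj u≤L v≤L (trans (sym (alternate-even α β s)) (trans eq (alternate-even α β t))))
... | odd s  | odd t  =
  cong (λ w → suc (w + w)) (β-inj u≤L v≤L (trans (sym (alternate-odd α β s)) (trans eq (alternate-odd α β t))))
... | even s | odd t  =
  contradiction (trans (sym (alternate-even α β s)) (trans eq (alternate-odd α β t))) (α≢β u≤L v≤L)
... | odd s  | even t =
  contradiction (trans (sym (alternate-even α β t)) (trans (sym eq) (alternate-odd α β s))) (α≢β v≤L u≤L)

pad : {V : Set} {r : ℕ} → V → (Fin r → V) → ℕ → V
pad {r = zero}  z g t       = z
pad {r = suc r} z g zero    = g zero
pad {r = suc r} z g (suc t) = pad z (g ∘ suc) t

pad-toℕ : ∀ {V : Set} {r} (z : V) (g : Fin r → V) t → pad z g (toℕ t) ≡ g t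
pad-toℕ z g zero    = refl
pad-toℕ z g (suc t) = pad-toℕ z (g ∘ suc) t

pad-< : ∀ {V : Set} {r t} (z : V) (g : Fin r → V) (t<r : t < r) → pad z g t ≡ g (fromℕ< t<r)
pad-< z g t<r = trans (cong (pad z g) (sym (toℕ-fromℕ< t<r))) (pad-toℕ z g (fromℕ< t<r))

pad-end : ∀ {V : Set} {r} (z : V) (g : Fin r → V) → pad z g r ≡ z
pad-end {r = zero}  z g = refl
pad-end {r = suc r} z g = pad-end z (g ∘ suc)

-- Decompositions into paths

infix 4 _∼_

_∼_ : {V : Set} → V × V → V × V → Set
(a , b) ∼ (c , d) = (a ≡ c × b ≡ d) ⊎ (a ≡ d × b ≡ c)

∼-refl : ∀ {V : Set} {p : V × V} → p ∼ p
∼-refl = inj₁ (refl , refl)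

∼-flip : ∀ {V : Set} {a b : V} → (a , b) ∼ (b , a)
∼-flip = inj₂ (refl , refl)

∼-sym : ∀ {V : Set} {p q : V × V} → p ∼ q → q ∼ p
∼-sym (inj₁ (refl , refl)) = inj₁ (refl , refl)
∼-sym (inj₂ (refl , refl)) = inj₂ (refl , refl)

∼-trans : ∀ {V : Set} {p q r : V × V} → p ∼ q → q ∼ r → p ∼ r
∼-trans (inj₁ (refl , refl)) q∼r = q∼r
∼-trans (inj₂ (refl , refl)) (inj₁ (refl , refl)) = inj₂ (refl , refl)
∼-trans (inj₂ (refl , refl)) (inj₂ (refl , refl)) = inj₁ (refl , refl)

step : {V : Set} → (ℕ → V) → ℕ → V × V
step w u = w u , w (suc u)

-- A partition of the edges E, with the given end vertices, into paths with L
-- edges.  Only the values of a walk at 0, …, L matter.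
record Decomposition (L : ℕ) {V E : Set} (ends : E → V × V) : Set₁ where
  field
    Index      : Set
    indices    : List Index
    enumerated : ∀ i → i ∈ indices
    walk       : Index → ℕ → V
    walk-inj   : ∀ i → InjectiveUpTo L (walk i)
    owner      : E → Index
    covered    : ∀ e → ∃ λ u → u < L × ends e ∼ step (walk (owner e)) u
    owned      : ∀ i {u} → u < L → ∃ λ e → owner e ≡ i × ends e ∼ step (walk i) u

open Decomposition

infixr 5 _∪_

_∪_ : ∀ {L} {V E F : Set} {ends : E → V × V} {ends′ : F → V × V} →
      Decomposition L ends → Decomposition L ends′ → Decomposition L [ ends , ends′ ]
_∪_ {L} {V} {E} {F} {ends} {ends′} A B = record
  { Index      = Index A ⊎ Index B
  ; indices    = map inj₁ (indices A) ++ map inj₂ (indices B)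
  ; enumerated = λ { (inj₁ i) → ∈-++⁺ˡ (∈-map⁺ inj₁ (enumerated A i))
                   ; (inj₂ i) → ∈-++⁺ʳ (map inj₁ (indices A)) (∈-map⁺ inj₂ (enumerated B i)) }
  ; walk       = [ walk A , walk B ]
  ; walk-inj   = λ { (inj₁ i) → walk-inj A i ; (inj₂ i) → walk-inj B i }
  ; owner      = λ { (inj₁ e) → inj₁ (owner A e) ; (inj₂ e) → inj₂ (owner B e) }
  ; covered    = λ { (inj₁ e) → covered A e ; (inj₂ e) → covered B e }
  ; owned      = λ { (inj₁ i) u<L → let e , o , c = owned A i u<L in inj₁ e , cong inj₁ o , c
                   ; (inj₂ i) u<L → let e , o , c = owned B i u<L in inj₂ e , cong inj₂ o , c }
  }

⋃ : ∀ {L q} {V E : Set} {ends : Fin q → E → V × V} →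
    (∀ a → Decomposition L (ends a)) → Decomposition L (uncurry ends)
⋃ {q = q} D = record
  { Index      = Σ (Fin q) (λ a → Index (D a))
  ; indices    = concatMap (λ a → map (a ,_) (indices (D a))) (allFin q)
  ; enumerated = λ { (a , i) → ∈-concat⁺′ (∈-map⁺ (a ,_) (enumerated (D a) i))
                                 (∈-map⁺ (λ a → map (a ,_) (indices (D a))) (∈-allFin a)) }
  ; walk       = λ { (a , i) → walk (D a) i }
  ; walk-inj   = λ { (a , i) → walk-inj (D a) i }
  ; owner      = λ { (a , e) → a , owner (D a) e }
  ; covered    = λ { (a , e) → covered (D a) e }
  ; owned      = λ { (a , i) u<L → let e , o , c = owned (D a) i u<L in (a , e) , cong (a ,_) o , c }
  }

relabel : ∀ {L} {V E F : Set} {ends : E → V × V} {ends′ : F → V × V} (φ : E ↔ F) →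
          (∀ e → ends′ (Inverse.to φ e) ∼ ends e) →
          Decomposition L ends → Decomposition L ends′
relabel {ends = ends} {ends′} φ same D = record
  { Index      = Index D
  ; indices    = indices D
  ; enumerated = enumerated D
  ; walk       = walk D
  ; walk-inj   = walk-inj D
  ; owner      = owner D ∘ from
  ; covered    = λ f → let u , u<L , c = covered D (from f) in
      u , u<L , ∼-trans (subst (λ g → ends′ g ∼ ends (from f)) (strictlyInverseˡ f) (same (from f))) c
  ; owned      = λ i u<L → let e , o , c = owned D i u<L in
      to e , trans (cong (owner D) (strictlyInverseʳ e)) o , ∼-trans (same e) c
  }
  where open Inverse φ

unrotate-free : ∀ {n u v} (x : Fin (suc n)) → u ≤ n → v ≤ n → unrotate u x ≡ unrotate v x → u ≡ v
unrotate-free {u = u} {v} x u≤n v≤n eq = rotate-free x u≤n v≤n (begin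
  rotate u x                          ≡⟨ cong (rotate u) (rotate-unrotate v x) ⟨
  rotate u (rotate v (unrotate v x))  ≡⟨ cong (rotate u ∘ rotate v) eq ⟨
  rotate u (rotate v (unrotate u x))  ≡⟨ rotate-comm u v (unrotate u x) ⟩
  rotate v (rotate u (unrotate u x))  ≡⟨ cong (rotate v) (rotate-unrotate u x) ⟩
  rotate v x                          ∎)
  where open ≡-Reasoning

step-even : ∀ {V : Set} (α β : ℕ → V) s → step (alternate α β) (s + s) ≡ (α s , β s)
step-even α β s = cong₂ _,_ (alternate-even α β s) (alternate-odd α β s)

step-odd : ∀ {V : Set} (α β : ℕ → V) s → step (alternate α β) (suc (s + s)) ≡ (β s , α (suc s))
step-odd α β s = cong₂ _,_ (alternate-odd α β s) (alternate-suc-odd α β s)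

OnAlternating : {V : Set} → ℕ → (ℕ → V) → (ℕ → V) → V × V → Set
OnAlternating L α β p =
  (∃ λ s → s + s < L × p ∼ (α s , β s)) ⊎ (∃ λ s → suc (s + s) < L × p ∼ (β s , α (suc s)))

alternating : ∀ {L m} {V E : Set} {ends : E → V × V}
  (α β : Fin m → ℕ → V) (own : E → Fin m) →
  (∀ i → InjectiveUpTo L (alternate (α i) (β i))) →
  (∀ e → OnAlternating L (α (own e)) (β (own e)) (ends e)) →
  (∀ i s → s + s < L → ∃ λ e → own e ≡ i × ends e ∼ (α i s , β i s)) →
  (∀ i s → suc (s + s) < L → ∃ λ e → own e ≡ i × ends e ∼ (β i s , α i (suc s))) →
  Decomposition L ends
alternating {L} {m} {V} {E} {ends} α β own inj cov own-even own-odd = record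
  { Index      = Fin m
  ; indices    = allFin m
  ; enumerated = ∈-allFin
  ; walk       = λ i → alternate (α i) (β i)
  ; walk-inj   = inj
  ; owner      = own
  ; covered    = covers
  ; owned      = owns
  }
  where
  covers : ∀ e → ∃ λ u → u < L × ends e ∼ step (alternate (α (own e)) (β (own e))) u
  covers e with cov e
  ... | inj₁ (s , lt , c) = s + s , lt , subst (ends e ∼_) (sym (step-even _ _ s)) c
  ... | inj₂ (s , lt , c) = suc (s + s) , lt , subst (ends e ∼_) (sym (step-odd _ _ s)) c

  owns : ∀ i {u} → u < L → ∃ λ e → own e ≡ i × ends e ∼ step (alternate (α i) (β i)) u
  owns i {u} u<L with halving u
  ... | even s = let e , o , c = own-even i s u<L in e , o , subst (ends e ∼_) (sym (step-even _ _ s)) c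
  ... | odd s  = let e , o , c = own-odd i s u<L in e , o , subst (ends e ∼_) (sym (step-odd _ _ s)) c

-- Complete bipartite graphs

between : {V X Y : Set} → (X → V) → (Y → V) → X × Y → V × V
between f g (x , y) = f x , g y

Disjoint : {V X Y : Set} → (X → V) → (Y → V) → Set
Disjoint f g = ∀ {x y} → f x ≢ g y

-- The j-th path is f j, g j, f (j - 1), g (j + 1), f (j - 2), g (j + 2), …, and
-- its consecutive edges have differences 0, 1, 2, … modulo 2 r + 1.
module Square {V : Set} {r : ℕ} (f g : Fin (suc (r + r)) → V)
  (f-inj : Injective _≡_ _≡_ f) (g-inj : Injective _≡_ _≡_ g) (f≢g : Disjoint f g) where

  α β : Fin (suc (r + r)) → ℕ → V
  α j t = f (unrotate t j)
  β j t = g (rotate t j)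

  own : Fin (suc (r + r)) × Fin (suc (r + r)) → Fin (suc (r + r))
  own (x , y) = rotate ⌈ offset x y /2⌉ x

  half≤ : ∀ {s} → s + s ≤ suc (r + r) → s ≤ r + r
  half≤ le = ≤-trans (double-cancel-≤ le) (m≤m+n r r)

  covers : ∀ x y δ → δ ≤ r + r → rotate δ x ≡ y →
    OnAlternating (suc (r + r)) (α (rotate ⌈ δ /2⌉ x)) (β (rotate ⌈ δ /2⌉ x)) (f x , g y)
  covers x y δ δ≤ refl with halving δ
  ... | even s rewrite ⌈double/2⌉ s = inj₁ (s , s≤s δ≤ , inj₁
          (cong f (sym (unrotate-rotate s x)) , cong g (sym (rotate-+ s s x))))
  ... | odd s rewrite ⌊double/2⌋ s = inj₂ (s , s≤s δ≤ , inj₂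
          (cong f (sym (unrotate-rotate (suc s) x)) , cong g (sym (rotate-+ s (suc s) x))))

  own-unrotate : ∀ j u v → u + v ≤ r + r → ⌈ u + v /2⌉ ≡ u → own (unrotate u j , rotate v j) ≡ j
  own-unrotate j u v le half = begin
    rotate ⌈ offset (unrotate u j) (rotate v j) /2⌉ (unrotate u j)
      ≡⟨ cong (λ δ → rotate ⌈ δ /2⌉ (unrotate u j)) (offset-unique _ _ le turn) ⟩
    rotate ⌈ u + v /2⌉ (unrotate u j)  ≡⟨ cong (λ w → rotate w (unrotate u j)) half ⟩
    rotate u (unrotate u j)            ≡⟨ rotate-unrotate u j ⟩
    j                                  ∎
    where
    open ≡-Reasoning
    turn : rotate (u + v) (unrotate u j) ≡ rotate v j
    turn = trans (sym (rotate-+ v u _)) (cong (rotate v) (rotate-unrotate u j))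

  square : Decomposition (suc (r + r)) (between f g)
  square = alternating α β own
    (λ j → alternate-injective (α j) (β j) (suc (r + r))
      (λ s≤ t≤ eq → unrotate-free j (half≤ s≤) (half≤ t≤) (f-inj eq))
      (λ s< t< eq → rotate-free j (half≤ (<⇒≤ s<)) (half≤ (<⇒≤ t<)) (g-inj eq))
      (λ _ _ → f≢g))
    (λ { (x , y) → covers x y (offset x y) (offset≤n x y) (rotate-offset x y) })
    (λ j s lt → (unrotate s j , rotate s j) , own-unrotate j s s (≤-pred lt) (⌈double/2⌉ s) , ∼-refl)
    (λ j s lt → (unrotate (suc s) j , rotate s j) ,
                own-unrotate j (suc s) s (≤-pred lt) (cong suc (⌊double/2⌋ s)) , ∼-flip)

-- The 2 (c + 1) columns are two copies of ℤ/(c + 1).  The i-th path is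
-- ζ, column i 0, row 0, column i 1, row 1, …, row (r - 1), column i r.
module Strip {V : Set} {c r : ℕ} (ζ : V) (col : Fin (suc c) ⊎ Fin (suc c) → V) (row : Fin r → V)
  (col-inj : Injective _≡_ _≡_ col) (row-inj : Injective _≡_ _≡_ row) (col≢row : Disjoint col row)
  (ζ≢col : ∀ {y} → ζ ≢ col y) (ζ≢row : ∀ {t} → ζ ≢ row t) (r≤ : r ≤ suc (c + c)) where

  Column : Set
  Column = Fin (suc c) ⊎ Fin (suc c)

  left right : Fin (suc c) → ℕ → Column
  left  i u = inj₁ (rotate u i)
  right i u = inj₂ (rotate u i)

  column : Fin (suc c) → ℕ → Column
  column i = alternate (left i) (right i)

  column-inj : ∀ i → InjectiveUpTo r (column i)
  column-inj i = alternate-injective (left i) (right i) r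
    (λ s≤ t≤ eq → rotate-free i (double-cancel-≤ (≤-trans s≤ r≤)) (double-cancel-≤ (≤-trans t≤ r≤)) (inj₁-injective eq))
    (λ s< t< eq → rotate-free i (double-cancel-≤ (≤-trans (<⇒≤ s<) r≤)) (double-cancel-≤ (≤-trans (<⇒≤ t<) r≤)) (inj₂-injective eq))
    (λ _ _ ())

  α β : Fin (suc c) → ℕ → V
  α i zero    = ζ
  α i (suc t) = pad ζ row t
  β i s       = col (column i s)

  stripEnds : Fin (suc c) ⊎ (Column × Fin r) → V × V
  stripEnds = [ (λ i → col (inj₁ i) , ζ) , between col row ]

  start : Column → ℕ → Fin (suc c)
  start (inj₁ y) t = unrotate ⌈ t /2⌉ y
  start (inj₂ y) t = unrotate ⌊ t /2⌋ y

  own : Fin (suc c) ⊎ (Column × Fin r) → Fin (suc c)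
  own (inj₁ i)       = i
  own (inj₂ (y , t)) = start y (toℕ t)

  column-even : ∀ i s → column i (s + s) ≡ inj₁ (rotate s i)
  column-even i s = alternate-even (left i) (right i) s

  column-odd : ∀ i s → column i (suc (s + s)) ≡ inj₂ (rotate s i)
  column-odd i s = alternate-odd (left i) (right i) s

  column-suc-odd : ∀ i s → column i (suc (suc (s + s))) ≡ inj₁ (rotate (suc s) i)
  column-suc-odd i s = alternate-suc-odd (left i) (right i) s

  start-column : ∀ i t → start (column i t) t ≡ i
  start-column i t with halving t
  ... | even s rewrite column-even i s | ⌈double/2⌉ s = unrotate-rotate s i
  ... | odd s  rewrite column-odd i s  | ⌈double/2⌉ s = unrotate-rotate s i

  start-column-suc : ∀ i t → start (column i (suc t)) t ≡ i
  start-column-suc i t with halving t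
  ... | even s rewrite column-odd i s     | ⌊double/2⌋ s = unrotate-rotate s i
  ... | odd s  rewrite column-suc-odd i s | ⌊double/2⌋ s = unrotate-rotate (suc s) i

  column-start : ∀ y t → column (start y t) t ≡ y ⊎ column (start y t) (suc t) ≡ y
  column-start (inj₁ y) t with halving t
  ... | even s rewrite ⌈double/2⌉ s =
          inj₁ (trans (column-even _ s) (cong inj₁ (rotate-unrotate s y)))
  ... | odd s rewrite ⌊double/2⌋ s =
          inj₂ (trans (column-suc-odd _ s) (cong inj₁ (rotate-unrotate (suc s) y)))
  column-start (inj₂ y) t with halving t
  ... | even s rewrite ⌊double/2⌋ s =
          inj₂ (trans (column-odd _ s) (cong inj₂ (rotate-unrotate s y)))
  ... | odd s rewrite ⌈double/2⌉ s =
          inj₁ (trans (column-odd _ s) (cong inj₂ (rotate-unrotate s y)))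

  α-inj : ∀ i {s t} → s ≤ r → t ≤ r → α i s ≡ α i t → s ≡ t
  α-inj i {zero}  {zero}  _   _   _  = refl
  α-inj i {zero}  {suc t} _   t<r eq = contradiction (trans eq (pad-< ζ row t<r)) ζ≢row
  α-inj i {suc s} {zero}  s<r _   eq = contradiction (trans (sym eq) (pad-< ζ row s<r)) ζ≢row
  α-inj i {suc s} {suc t} s<r t<r eq = cong suc (begin
    s                   ≡⟨ toℕ-fromℕ< s<r ⟨
    toℕ (fromℕ< s<r)    ≡⟨ cong toℕ (row-inj (trans (sym (pad-< ζ row s<r)) (trans eq (pad-< ζ row t<r)))) ⟩
    toℕ (fromℕ< t<r)    ≡⟨ toℕ-fromℕ< t<r ⟩
    t                   ∎)
    where open ≡-Reasoning

  α≢β : ∀ i {s t} → s ≤ r → α i s ≢ β i t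
  α≢β i {zero}  _   eq = ζ≢col eq
  α≢β i {suc s} s<r eq = col≢row (trans (sym eq) (pad-< ζ row s<r))

  start-edge : ∀ i → col (inj₁ i) ≡ β i 0
  start-edge i = cong (col ∘ inj₁) (sym (rotate-0 i))

  covers : ∀ e → OnAlternating (suc (r + r)) (α (own e)) (β (own e)) (stripEnds e)
  covers (inj₁ i) = inj₁ (0 , s≤s z≤n , inj₂ (start-edge i , refl))
  covers (inj₂ (y , t)) with column-start y (toℕ t)
  ... | inj₁ eq = inj₂ (toℕ t , s≤s (<⇒≤ (double-mono-< (toℕ<n t))) , inj₁ (cong col (sym eq) , sym (pad-toℕ ζ row t)))
  ... | inj₂ eq = inj₁ (suc (toℕ t) , s≤s (+-mono-≤ (toℕ<n t) (toℕ<n t)) , inj₂ (cong col (sym eq) , sym (pad-toℕ ζ row t)))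

  owns-even : ∀ i s → s + s < suc (r + r) → ∃ λ e → own e ≡ i × stripEnds e ∼ (α i s , β i s)
  owns-even i zero    _  = inj₁ i , refl , inj₂ (start-edge i , refl)
  owns-even i (suc t) lt = inj₂ (column i (suc t) , fromℕ< t<r) ,
    trans (cong (start (column i (suc t))) (toℕ-fromℕ< t<r)) (start-column-suc i t) ,
    inj₂ (refl , sym (pad-< ζ row t<r))
    where t<r = double-cancel-≤ (<⇒≤ lt)

  owns-odd : ∀ i s → suc (s + s) < suc (r + r) → ∃ λ e → own e ≡ i × stripEnds e ∼ (β i s , α i (suc s))
  owns-odd i s lt = inj₂ (column i s , fromℕ< s<r) ,
    trans (cong (start (column i s)) (toℕ-fromℕ< s<r)) (start-column i s) ,
    inj₁ (refl , sym (pad-< ζ row s<r))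
    where s<r = double-cancel-< (≤-pred lt)

  strip : Decomposition (suc (r + r)) stripEnds
  strip = alternating α β own
    (λ i → alternate-injective (α i) (β i) (suc (r + r))
      (λ s≤ t≤ → α-inj i (double-cancel-≤ s≤) (double-cancel-≤ t≤))
      (λ s< t< eq → column-inj i (double-cancel-≤ (<⇒≤ s<)) (double-cancel-≤ (<⇒≤ t<)) (col-inj eq))
      (λ {s} {t} s≤ _ → α≢β i {s} {t} (double-cancel-≤ s≤)))
    covers owns-even owns-odd

-- Complete graphs

Pair : ℕ → Set
Pair zero    = ⊥
Pair (suc n) = Fin n ⊎ Pair n

least greatest : ∀ {n} → Pair n → Fin n
least    {suc n} (inj₁ j) = zero
least    {suc n} (inj₂ e) = suc (least e)
greatest {suc n} (inj₁ j) = suc j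
greatest {suc n} (inj₂ e) = suc (greatest e)

among : ∀ {V : Set} {n} → (Fin n → V) → Pair n → V × V
among f e = f (least e) , f (greatest e)

least≢greatest : ∀ {n} (e : Pair n) → least e ≢ greatest e
least≢greatest {suc n} (inj₂ e) eq = least≢greatest e (suc-injective eq)

pair : ∀ {n} {x y : Fin n} → x ≢ y → ∃ λ e → among id e ∼ (x , y)
pair {suc n} {zero}  {zero}  x≢y = contradiction refl x≢y
pair {suc n} {zero}  {suc y} x≢y = inj₁ y , ∼-refl
pair {suc n} {suc x} {zero}  x≢y = inj₁ x , ∼-flip
pair {suc n} {suc x} {suc y} x≢y with pair (x≢y ∘ cong suc)
... | e , inj₁ (refl , refl) = inj₂ e , ∼-refl
... | e , inj₂ (refl , refl) = inj₂ e , ∼-flip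

-- The i-th path is i, i + 1, i - 1, i + 2, i - 2, …, i + c + 1 modulo
-- 2 (c + 1), for i ≤ c; the edge of difference δ from x lies on the path of
-- x + ⌊δ/2⌋, reduced modulo c + 1.
module Zigzag {V : Set} {c : ℕ} (f : Fin (suc c + suc c) → V) (f-inj : Injective _≡_ _≡_ f) where

  b N-1 : ℕ
  b   = suc c
  N-1 = c + suc c

  N-1≡ : N-1 ≡ suc (c + c)
  N-1≡ = +-suc c c

  inc : Fin b → Fin (b + b)
  inc i = i ↑ˡ b

  fold : Fin (b + b) → Fin b
  fold j = [ id , id ] (splitAt b j)

  rotate-inc : ∀ i → rotate b (inc i) ≡ b ↑ʳ i
  rotate-inc i = toℕ-injective (begin
    toℕ (rotate b (inc i))  ≡⟨ toℕ-rotate-< b (inc i) (subst (λ z → z + b < b + b) (sym (toℕ-↑ˡ i b)) (+-monoˡ-< b (toℕ<n i))) ⟩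
    toℕ (inc i) + b         ≡⟨ cong (_+ b) (toℕ-↑ˡ i b) ⟩
    toℕ i + b               ≡⟨ +-comm (toℕ i) b ⟩
    b + toℕ i               ≡⟨ toℕ-↑ʳ b i ⟨
    toℕ (b ↑ʳ i)            ∎)
    where open ≡-Reasoning

  rotate-↑ʳ : ∀ i → rotate b (b ↑ʳ i) ≡ inc i
  rotate-↑ʳ i = begin
    rotate b (b ↑ʳ i)            ≡⟨ cong (rotate b) (rotate-inc i) ⟨
    rotate b (rotate b (inc i))  ≡⟨ rotate-+ b b (inc i) ⟩
    rotate (b + b) (inc i)       ≡⟨ cong (λ w → rotate w (inc i)) (+-identityʳ (b + b)) ⟨
    rotate (1 * (b + b)) (inc i) ≡⟨ rotate-multiple 1 (inc i) ⟩
    inc i                        ∎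
    where open ≡-Reasoning

  antipode : ∀ j → (∃ λ i → j ≡ inc i × rotate b j ≡ b ↑ʳ i) ⊎ (∃ λ i → j ≡ b ↑ʳ i × rotate b j ≡ inc i)
  antipode j with splitAt b j | join-splitAt b b j
  ... | inj₁ i | refl = inj₁ (i , refl , rotate-inc i)
  ... | inj₂ i | refl = inj₂ (i , refl , rotate-↑ʳ i)

  fold-inc : ∀ i → fold (inc i) ≡ i
  fold-inc i = cong [ id , id ] (splitAt-↑ˡ b i b)

  fold-↑ʳ : ∀ i → fold (b ↑ʳ i) ≡ i
  fold-↑ʳ i = cong [ id , id ] (splitAt-↑ʳ b b i)

  fold-antipode : ∀ j → fold (rotate b j) ≡ fold j
  fold-antipode j with antipode j
  ... | inj₁ (i , refl , eq) = trans (cong fold eq) (trans (fold-↑ʳ i) (sym (fold-inc i)))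
  ... | inj₂ (i , refl , eq) = trans (cong fold eq) (trans (fold-inc i) (sym (fold-↑ʳ i)))

  centre : Fin (b + b) → Fin (b + b) → Fin (b + b)
  centre x y = rotate ⌊ offset x y /2⌋ x

  private
    rotate-≡ : ∀ {u v} (x : Fin (b + b)) → u ≡ v → rotate u x ≡ rotate v x
    rotate-≡ x eq = cong (λ w → rotate w x) eq

  centre-flip : ∀ {x y δ ε u v} → offset x y ≡ δ → δ + ε ≡ b + b → 0 < δ →
    ⌊ δ /2⌋ ≡ u → ⌊ ε /2⌋ ≡ v → δ + v ≡ u + b → centre y x ≡ rotate b (centre x y)
  centre-flip {x} {y} {suc δ} {ε} {u} {v} off total _ hδ hε turn = begin
    rotate ⌊ offset y x /2⌋ y   ≡⟨ rotate-≡ y (trans (cong ⌊_/2⌋ back) hε) ⟩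
    rotate v y                  ≡⟨ cong (rotate v) y≡ ⟩
    rotate v (rotate (suc δ) x) ≡⟨ rotate-+ v (suc δ) x ⟩
    rotate (suc δ + v) x        ≡⟨ rotate-≡ x turn ⟩
    rotate (u + b) x            ≡⟨ rotate-+ b u x ⟨
    rotate b (rotate u x)       ≡⟨ cong (rotate b) (rotate-≡ x (trans (cong ⌊_/2⌋ off) hδ)) ⟨
    rotate b (centre x y)       ∎
    where
    open ≡-Reasoning
    y≡ : y ≡ rotate (suc δ) x
    y≡ = trans (sym (rotate-offset x y)) (rotate-≡ x off)
    back : offset y x ≡ ε
    back = offset-unique y x (subst (ε ≤_) (ℕ.suc-injective total) (m≤n+m ε δ)) (begin
      rotate ε y                   ≡⟨ cong (rotate ε) y≡ ⟩
      rotate ε (rotate (suc δ) x)  ≡⟨ rotate-+ ε (suc δ) x ⟩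
      rotate (suc δ + ε) x         ≡⟨ rotate-≡ x (trans total (sym (+-identityʳ (b + b)))) ⟩
      rotate (1 * (b + b)) x       ≡⟨ rotate-multiple 1 x ⟩
      x                            ∎)

  offset>0 : ∀ {x y} → x ≢ y → 0 < offset x y
  offset>0 {x} {y} x≢y = n≢0⇒n>0 λ eq →
    x≢y (trans (sym (rotate-0 x)) (trans (rotate-≡ x (sym eq)) (rotate-offset x y)))

  centre-swap : ∀ {x y} → x ≢ y → centre y x ≡ rotate b (centre x y)
  centre-swap {x} {y} x≢y = by-parity (halving (offset x y)) refl (offset>0 x≢y)
    where
    δ≤ : offset x y ≤ suc (c + c)
    δ≤ = subst (offset x y ≤_) N-1≡ (offset≤n x y)

    by-parity : ∀ {δ} → Halving δ → offset x y ≡ δ → 0 < δ → centre y x ≡ rotate b (centre x y)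
    by-parity (odd s) off pos
      with t , eq ← m≤n⇒∃[o]m+o≡n (double-cancel-≤ {s} {c} (≤-trans (n≤1+n _) (subst (_≤ suc (c + c)) off δ≤))) =
      centre-flip off (trans (total s t) (cong (λ z → suc z + suc z) eq)) pos
        (⌈double/2⌉ s) (⌈double/2⌉ t) (trans (turn s t) (cong (λ z → s + suc z) eq))
      where
      total : ∀ s t → suc (s + s) + suc (t + t) ≡ suc (s + t) + suc (s + t)
      total = solve-∀
      turn : ∀ s t → suc (s + s) + t ≡ s + suc (s + t)
      turn = solve-∀
    by-parity (even s) off pos
      with t , eq ← m≤n⇒∃[o]m+o≡n (≤-trans (double-cancel-≤ {s} {c} (subst (_≤ suc (c + c)) off δ≤)) (n≤1+n c)) =
      centre-flip off (trans (total s t) (cong (λ z → z + z) eq)) pos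
        (⌊double/2⌋ s) (⌊double/2⌋ t) (trans (turn s t) (cong (s +_) eq))
      where
      total : ∀ s t → s + s + (t + t) ≡ s + t + (s + t)
      total = solve-∀
      turn : ∀ s t → s + s + t ≡ s + (s + t)
      turn = solve-∀

  own : Pair (b + b) → Fin b
  own e = fold (centre (least e) (greatest e))

  fold-centre : ∀ {x y e} → among id e ∼ (x , y) → own e ≡ fold (centre x y)
  fold-centre (inj₁ (refl , refl)) = refl
  fold-centre {e = e} (inj₂ (refl , refl)) =
    sym (trans (cong fold (centre-swap (least≢greatest e))) (fold-antipode _))

  α β : Fin b → ℕ → V
  α i s = f (unrotate s (inc i))
  β i s = f (rotate (suc s) (inc i))

  on-path : ∀ {x y i} → x ≢ y → centre x y ≡ inc i → OnAlternating (suc (c + c)) (α i) (β i) (f x , f y)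
  on-path {x} {y} {i} x≢y eq =
    by-parity (halving (offset x y)) refl (offset>0 x≢y) (subst (offset x y ≤_) N-1≡ (offset≤n x y))
    where
    shifted : ∀ {δ s} → offset x y ≡ δ → ⌊ δ /2⌋ ≡ s → rotate s x ≡ inc i
    shifted off half = trans (rotate-≡ x (trans (sym half) (cong ⌊_/2⌋ (sym off)))) eq

    end : ∀ {δ} s t → offset x y ≡ δ → rotate s x ≡ inc i → δ ≡ s + t → y ≡ rotate t (inc i)
    end {δ} s t off sh sum = begin
      y                      ≡⟨ rotate-offset x y ⟨
      rotate (offset x y) x  ≡⟨ rotate-≡ x (trans off sum) ⟩
      rotate (s + t) x       ≡⟨ rotate-+ t s x ⟨
      rotate t (rotate s x)  ≡⟨ cong (rotate t) sh ⟩
      rotate t (inc i)       ∎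
      where open ≡-Reasoning

    source : ∀ s → rotate s x ≡ inc i → x ≡ unrotate s (inc i)
    source s sh = trans (sym (unrotate-rotate s x)) (cong (unrotate s) sh)

    by-parity : ∀ {δ} → Halving δ → offset x y ≡ δ → 0 < δ → offset x y ≤ suc (c + c) →
      OnAlternating (suc (c + c)) (α i) (β i) (f x , f y)
    by-parity (odd s) off _ δ≤ =
      let sh = shifted off (⌈double/2⌉ s) in
      inj₁ (s , subst (_≤ suc (c + c)) off δ≤ ,
        inj₁ (cong f (source s sh) , cong f (end s (suc s) off sh (sym (+-suc s s)))))
    by-parity (even (suc s)) off _ δ≤ =
      let sh = shifted off (⌊double/2⌋ (suc s)) in
      inj₂ (s , subst (_≤ suc (c + c)) (trans off (cong suc (+-suc s s))) δ≤ ,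
        inj₂ (cong f (source (suc s) sh) , cong f (end (suc s) (suc s) off sh refl)))

  covers : ∀ e → OnAlternating (suc (c + c)) (α (own e)) (β (own e)) (among f e)
  covers e with antipode (centre (least e) (greatest e))
  ... | inj₁ (i , eq , _) =
    on-path (least≢greatest e) (trans eq (cong inc (sym (trans (cong fold eq) (fold-inc i)))))
  ... | inj₂ (i , eq , opp) = flipped (on-path (least≢greatest e ∘ sym)
      (trans (centre-swap (least≢greatest e)) (trans opp (cong inc (sym (trans (cong fold eq) (fold-↑ʳ i)))))))
    where
    flipped : ∀ {i x y} → OnAlternating (suc (c + c)) (α i) (β i) (x , y) →
              OnAlternating (suc (c + c)) (α i) (β i) (y , x)
    flipped (inj₁ (s , lt , p)) = inj₁ (s , lt , ∼-trans ∼-flip p)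
    flipped (inj₂ (s , lt , p)) = inj₂ (s , lt , ∼-trans ∼-flip p)

  owns : ∀ i u v → 0 < u + v → u + v ≤ N-1 → ⌊ u + v /2⌋ ≡ u →
    ∃ λ e → own e ≡ i × among f e ∼ (f (unrotate u (inc i)) , f (rotate v (inc i)))
  owns i u v pos le half = e , trans (fold-centre e∼) (trans (cong fold central) (fold-inc i)) , f-ends e∼
    where
    open ≡-Reasoning
    x y : Fin (b + b)
    x = unrotate u (inc i)
    y = rotate v (inc i)

    turn : rotate (u + v) x ≡ y
    turn = trans (sym (rotate-+ v u x)) (cong (rotate v) (rotate-unrotate u (inc i)))

    x≢y : x ≢ y
    x≢y eq = <⇒≢ pos (rotate-free x z≤n le (trans (rotate-0 x) (trans eq (sym turn))))

    e : Pair (b + b)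
    e = proj₁ (pair x≢y)

    e∼ : among id e ∼ (x , y)
    e∼ = proj₂ (pair x≢y)

    central : centre x y ≡ inc i
    central = trans (rotate-≡ x (trans (cong ⌊_/2⌋ (offset-unique x y le turn)) half)) (rotate-unrotate u (inc i))

    f-ends : ∀ {e x y} → among id e ∼ (x , y) → among f e ∼ (f x , f y)
    f-ends (inj₁ (refl , refl)) = inj₁ (refl , refl)
    f-ends (inj₂ (refl , refl)) = inj₂ (refl , refl)

  zigzag : Decomposition (suc (c + c)) (among f)
  zigzag = alternating α β own injective covers
    (λ i s lt → owns i s (suc s) (subst (0 <_) (sym (+-suc s s)) (s≤s z≤n))
      (subst₂ _≤_ (sym (+-suc s s)) (sym N-1≡) lt) (trans (cong ⌊_/2⌋ (+-suc s s)) (⌈double/2⌉ s)))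
    (λ i s lt → let e , o , p = owns i (suc s) (suc s) (s≤s z≤n)
                                  (subst₂ _≤_ (cong suc (sym (+-suc s s))) (sym N-1≡) lt) (⌊double/2⌋ (suc s))
                in e , o , ∼-trans p ∼-flip)
    where
    ≤N-1 : ∀ {u} → u ≤ c → u ≤ N-1
    ≤N-1 le = ≤-trans le (m≤m+n c b)

    injective : ∀ i → InjectiveUpTo (suc (c + c)) (alternate (α i) (β i))
    injective i = alternate-injective (α i) (β i) (suc (c + c))
      (λ s≤ t≤ eq → unrotate-free (inc i) (≤N-1 (double-cancel-≤ s≤)) (≤N-1 (double-cancel-≤ t≤)) (f-inj eq))
      (λ s< t< eq → ℕ.suc-injective (rotate-free (inc i) (small s<) (small t<) (f-inj eq)))
      (λ {s} {t} s≤ t< eq → <⇒≢ (s≤s z≤n) (rotate-free (inc i) z≤n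
        (subst (suc t + s ≤_) (sym N-1≡) (s≤s (+-mono-≤ (double-cancel-≤ {t} {c} (<⇒≤ t<)) (double-cancel-≤ {s} {c} s≤))))
        (apart s t (f-inj eq))))
      where
      small : ∀ {s} → s + s < suc (c + c) → suc s ≤ N-1
      small s< = ≤-trans (s≤s (double-cancel-≤ (<⇒≤ s<))) (m≤n+m b c)
      apart : ∀ s t → unrotate s (inc i) ≡ rotate (suc t) (inc i) → rotate 0 (inc i) ≡ rotate (suc t + s) (inc i)
      apart s t eq = trans (rotate-0 (inc i)) (trans (sym (rotate-unrotate s (inc i)))
        (trans (cong (rotate s) eq) (rotate-+ s (suc t) (inc i))))

  zigzag-first : ∀ i → walk zigzag i 0 ≡ f (i ↑ˡ b)
  zigzag-first i = cong f (trans (sym (rotate-0 _)) (rotate-unrotate 0 (inc i)))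

  zigzag-last : ∀ i → walk zigzag i (suc (c + c)) ≡ f (b ↑ʳ i)
  zigzag-last i = trans (alternate-odd (α i) (β i) c) (cong f (rotate-inc i))

  zigzag-visits : ∀ i u → ∃ λ x → walk zigzag i u ≡ f x
  zigzag-visits i u with halving u
  ... | even s = _ , alternate-even (α i) (β i) s
  ... | odd s  = _ , alternate-odd (α i) (β i) s

module Extension {L : ℕ} {V E : Set} {ends : E → V × V} (D : Decomposition L ends)
  (before after : Index D → V)
  (before-fresh : ∀ i {u} → u ≤ L → before i ≢ walk D i u)
  (after-fresh : ∀ i {u} → u ≤ L → after i ≢ walk D i u)
  (before≢after : ∀ i → before i ≢ after i) where

  continued : Index D → ℕ → V
  continued i = pad {r = suc L} (after i) (walk D i ∘ toℕ)

  extendedWalk : Index D → ℕ → V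
  extendedWalk i zero    = before i
  extendedWalk i (suc u) = continued i u

  continued-≤ : ∀ i {u} → u ≤ L → continued i u ≡ walk D i u
  continued-≤ i u≤L = trans (pad-< (after i) (walk D i ∘ toℕ) (s≤s u≤L)) (cong (walk D i) (toℕ-fromℕ< (s≤s u≤L)))

  continued-end : ∀ i → continued i (suc L) ≡ after i
  continued-end i = pad-end {r = suc L} (after i) (walk D i ∘ toℕ)

  data Position : ℕ → Set where
    inside : ∀ {u} → u ≤ L → Position u
    last   : Position (suc L)

  position : ∀ {u} → u ≤ suc L → Position u
  position u≤ with m≤n⇒m<n∨m≡n u≤
  ... | inj₁ u<   = inside (≤-pred u<)
  ... | inj₂ refl = last

  continued-inj : ∀ i → InjectiveUpTo (suc L) (continued i)
  continued-inj i u≤ v≤ eq with position u≤ | position v≤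
  ... | inside p | inside q = walk-inj D i p q (trans (sym (continued-≤ i p)) (trans eq (continued-≤ i q)))
  ... | inside p | last     = contradiction (trans (sym (continued-end i)) (trans (sym eq) (continued-≤ i p))) (after-fresh i p)
  ... | last     | inside q = contradiction (trans (sym (continued-end i)) (trans eq (continued-≤ i q))) (after-fresh i q)
  ... | last     | last     = refl

  before-fresh′ : ∀ i {u} → u ≤ suc L → before i ≢ continued i u
  before-fresh′ i u≤ eq with position u≤
  ... | inside p = before-fresh i p (trans eq (continued-≤ i p))
  ... | last     = before≢after i (trans eq (continued-end i))

  extendedWalk-inj : ∀ i → InjectiveUpTo (suc (suc L)) (extendedWalk i)
  extendedWalk-inj i {zero}  {zero}  _       _       _  = refl
  extendedWalk-inj i {zero}  {suc v} _       (s≤s v≤) eq = contradiction eq (before-fresh′ i v≤)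
  extendedWalk-inj i {suc u} {zero}  (s≤s u≤) _       eq = contradiction (sym eq) (before-fresh′ i u≤)
  extendedWalk-inj i {suc u} {suc v} (s≤s u≤) (s≤s v≤) eq = cong suc (continued-inj i u≤ v≤ eq)

  extendedEnds : E ⊎ (Index D ⊎ Index D) → V × V
  extendedEnds = [ ends , [ (λ i → walk D i 0 , before i) , (λ i → walk D i L , after i) ] ]

  step-inside : ∀ i {u} → u < L → step (walk D i) u ≡ step (extendedWalk i) (suc u)
  step-inside i u<L = sym (cong₂ _,_ (continued-≤ i (<⇒≤ u<L)) (continued-≤ i u<L))

  step-first : ∀ i → (walk D i 0 , before i) ∼ step (extendedWalk i) 0
  step-first i = inj₂ (sym (continued-≤ i z≤n) , refl)

  step-last : ∀ i → (walk D i L , after i) ∼ step (extendedWalk i) (suc L)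
  step-last i = inj₁ (sym (continued-≤ i ≤-refl) , sym (continued-end i))

  extended : Decomposition (suc (suc L)) extendedEnds
  extended = record
    { Index      = Index D
    ; indices    = indices D
    ; enumerated = enumerated D
    ; walk       = extendedWalk
    ; walk-inj   = extendedWalk-inj
    ; owner      = own
    ; covered    = covers
    ; owned      = λ i u< → owns i u<
    }
    where
    own : E ⊎ (Index D ⊎ Index D) → Index D
    own = [ owner D , [ id , id ] ]

    covers : ∀ e → ∃ λ u → u < suc (suc L) × extendedEnds e ∼ step (extendedWalk (own e)) u
    covers (inj₁ e) = let u , u<L , p = covered D e in
      suc u , s≤s (≤-trans u<L (n≤1+n L)) , subst (ends e ∼_) (step-inside _ u<L) p
    covers (inj₂ (inj₁ i)) = 0 , s≤s z≤n , step-first i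
    covers (inj₂ (inj₂ i)) = suc L , ≤-refl , step-last i

    owns : ∀ i {u} → u < suc (suc L) → ∃ λ e → own e ≡ i × extendedEnds e ∼ step (extendedWalk i) u
    owns i {zero}  _ = inj₂ (inj₁ i) , refl , step-first i
    owns i {suc u} (s≤s u<) with position u<
    ... | inside u<L = let e , o , p = owned D i u<L in inj₁ e , o , subst (ends e ∼_) (step-inside i u<L) p
    ... | last       = inj₂ (inj₂ i) , refl , step-last i

≅-trans : ∀ {G H K} → G ≅ H → H ≅ K → G ≅ K
≅-trans φ ψ = record
  { bijection = _≅_.bijection ψ ↔-∘ _≅_.bijection φ
  ; adjacency = λ x y → _≅_.adjacency ψ _ _ ⇔-∘ _≅_.adjacency φ x y
  }

T-extensional : ∀ {a b} → (T a → T b) → (T b → T a) → a ≡ b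
T-extensional {true}  {true}  _ _ = refl
T-extensional {false} {false} _ _ = refl
T-extensional {true}  {false} f _ = contradiction (f tt) id
T-extensional {false} {true}  _ g = contradiction (g tt) id

isImage-cong : ∀ {G K} (f : Graph.V G → Graph.V K) {H H′ : Subgraph G} {I I′ : Subgraph K} →
               IsImage f H I → IsImage f H′ I′ → H ≈ H′ → I ≈ I′
isImage-cong {G} {K} f {H} {H′} {I} {I′} (vs , es) (vs′ , es′) (v≡ , e≡) =
  (λ y → T-extensional
    (λ t → let x , p , q = to (vs y) t in from (vs′ y) (x , p , subst T (v≡ x) q))
    (λ t → let x , p , q = to (vs′ y) t in from (vs y) (x , p , subst T (sym (v≡ x)) q))) ,
  (λ y z → T-extensional
    (λ t → let x , w , p , q , r = to (es y z) t in from (es′ y z) (x , w , p , q , subst T (e≡ x w) r))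
    (λ t → let x , w , p , q , r = to (es′ y z) t in from (es y z) (x , w , p , q , subst T (sym (e≡ x w)) r)))
  where open Equivalence

isImage-trans : ∀ {G H K} {f : Graph.V G → Graph.V H} {g : Graph.V H → Graph.V K} {h : Graph.V G → Graph.V K} →
                (∀ x → g (f x) ≡ h x) → {A : Subgraph G} {B : Subgraph H} {C : Subgraph K} →
                IsImage f A B → IsImage g B C → IsImage h A C
isImage-trans {f = f} {g} {h} gf≡h (vs , es) (vs′ , es′) =
  (λ z → mk⇔
    (λ t → let y , p , s = to (vs′ z) t ; x , q , r = to (vs y) s in
           x , trans (sym (gf≡h x)) (trans (cong g q) p) , r)
    (λ { (x , p , r) → from (vs′ z) (f x , trans (gf≡h x) p , from (vs (f x)) (x , refl , r)) })) ,
  (λ z z′ → mk⇔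
    (λ t → let y , y′ , p , p′ , s = to (es′ z z′) t ; x , x′ , q , q′ , r = to (es y y′) s in
           x , x′ , trans (sym (gf≡h x)) (trans (cong g q) p) , trans (sym (gf≡h x′)) (trans (cong g q′) p′) , r)
    (λ { (x , x′ , p , p′ , r) → from (es′ z z′)
           (f x , f x′ , trans (gf≡h x) p , trans (gf≡h x′) p′ , from (es (f x) (f x′)) (x , x′ , refl , refl , r)) }))
  where open Equivalence

isImage-id : ∀ {G} {f : Graph.V G → Graph.V G} → (∀ x → f x ≡ x) → {A : Subgraph G} → IsImage f A A
isImage-id {f = f} f≡id {A} =
  (λ y → mk⇔ (λ t → y , f≡id y , t) (λ { (x , refl , t) → subst (T ∘ Subgraph.vertex A) (sym (f≡id x)) t })) ,
  (λ y y′ → mk⇔ (λ t → y , y′ , f≡id y , f≡id y′ , t)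
    (λ { (x , x′ , refl , refl , t) → subst₂ (λ a b → T (Subgraph.edge A a b)) (sym (f≡id x)) (sym (f≡id x′)) t }))

Exhaustible : Set → Set₁
Exhaustible A = ∀ {P : A → Set} → (∀ x → Dec (P x)) → Dec (∃ P)

module Image (G : Graph) (search : Exhaustible (Graph.V G)) {m : ℕ} (f : Graph.V G → Fin m)
  (f-inj : Injective _≡_ _≡_ f) (H : Subgraph G) where

  open Graph G
  open Subgraph H

  IsVertex : Fin m → Set
  IsVertex y = ∃ λ x → f x ≡ y × T (vertex x)

  IsEdge : Fin m → Fin m → Set
  IsEdge y y′ = ∃₂ λ x x′ → f x ≡ y × f x′ ≡ y′ × T (edge x x′)

  isVertex? : ∀ y → Dec (IsVertex y)
  isVertex? y = search λ x → (f x ≟ y) ×-dec T? (vertex x)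

  isEdge? : ∀ y y′ → Dec (IsEdge y y′)
  isEdge? y y′ = search λ x → search λ x′ → (f x ≟ y) ×-dec (f x′ ≟ y′) ×-dec T? (edge x x′)

  abstract
    image : Subgraph (complete m)
    image = record
      { vertex   = λ y → ⌊ isVertex? y ⌋
      ; edge     = λ y y′ → ⌊ isEdge? y y′ ⌋
      ; edge-sym = λ {y} {y′} t → let x , x′ , p , p′ , q = toWitness {a? = isEdge? y y′} t in
                     fromWitness {a? = isEdge? y′ y} (x′ , x , p′ , p , edge-sym q)
      ; edge⊆    = λ {y} {y′} t y≡y′ → let x , x′ , p , p′ , q = toWitness {a? = isEdge? y y′} t in
                     ~-irrefl (f-inj (trans p (trans y≡y′ (sym p′)))) (edge⊆ q)
      ; endpoint = λ {y} {y′} t → let x , x′ , p , p′ , q = toWitness {a? = isEdge? y y′} t in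
                     fromWitness {a? = isVertex? y} (x , p , endpoint q)
      }

    isImage : IsImage {G} {complete m} f H image
    isImage = (λ y → mk⇔ (toWitness {a? = isVertex? y}) (fromWitness {a? = isVertex? y})) ,
              (λ y y′ → mk⇔ (toWitness {a? = isEdge? y y′}) (fromWitness {a? = isEdge? y y′}))

    image≅ : toGraph image ≅ toGraph H
    image≅ = record
      { bijection = mk↔ₛ′
          (λ { (y , t) → let x , _ , q = toWitness {a? = isVertex? y} t in x , q })
          (λ { (x , q) → f x , fromWitness {a? = isVertex? (f x)} (x , refl , q) })
          (λ { (x , q) → Σ-T-≡ vertex (f-inj (proj₁ (proj₂ (toWitness {a? = isVertex? (f x)} (fromWitness {a? = isVertex? (f x)} (x , refl , q)))))) })
          (λ { (y , t) → Σ-T-≡ (λ y → ⌊ isVertex? y ⌋) (proj₁ (proj₂ (toWitness {a? = isVertex? y} t))) })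
      ; adjacency = λ { (y , t) (y′ , t′) →
          let x  , p  , _ = toWitness {a? = isVertex? y} t
              x′ , p′ , _ = toWitness {a? = isVertex? y′} t′
          in mk⇔
            (λ e → let z , z′ , q , q′ , r = toWitness {a? = isEdge? y y′} e in
                   subst₂ (λ a b → T (edge a b)) (f-inj (trans q (sym p))) (f-inj (trans q′ (sym p′))) r)
            (λ r → fromWitness {a? = isEdge? y y′} (x , x′ , p , p′ , r)) }
      }
      where
      Σ-T-≡ : {A : Set} (P : A → Bool) {x y : A} {s : T (P x)} {t : T (P y)} → x ≡ y → (x , s) ≡ (y , t)
      Σ-T-≡ P {x} refl = cong (x ,_) (T-irrelevant {P x} _ _)

adjacent? : ∀ {k} (i j : Fin k) → Dec (Graph._~_ (path k) i j)
adjacent? i j = (toℕ j ℕ.≟ suc (toℕ i)) ⊎-dec (toℕ i ℕ.≟ suc (toℕ j))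

whole : ∀ k → Subgraph (path k)
whole k = record
  { vertex   = λ _ → true
  ; edge     = λ i j → ⌊ adjacent? i j ⌋
  ; edge-sym = λ {i} {j} t → fromWitness {a? = adjacent? j i} (Graph.~-sym (path k) {i} {j} (toWitness {a? = adjacent? i j} t))
  ; edge⊆    = λ {i} {j} t → toWitness {a? = adjacent? i j} t
  ; endpoint = λ _ → tt
  }

whole≅ : ∀ k → toGraph (whole k) ≅ path k
whole≅ k = record
  { bijection = mk↔ₛ′ proj₁ (_, tt) (λ _ → refl) (λ _ → refl)
  ; adjacency = λ { (i , _) (j , _) → mk⇔ (toWitness {a? = adjacent? i j}) (fromWitness {a? = adjacent? i j}) }
  }

module PathBlock {L m : ℕ} (w : ℕ → Fin m) (w-inj : InjectiveUpTo L w) where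

  visit : Fin (suc L) → Fin m
  visit = w ∘ toℕ

  visit-inj : Injective _≡_ _≡_ visit
  visit-inj {i} {j} eq = toℕ-injective (w-inj (toℕ≤pred[n] i) (toℕ≤pred[n] j) eq)

  open Image (path (suc L)) any? visit visit-inj (whole (suc L)) public using () renaming
    (image to block; isImage to block-isImage; image≅ to block≅whole)

  block≅path : toGraph block ≅ path (suc L)
  block≅path = ≅-trans block≅whole (whole≅ (suc L))

  block-edge : ∀ {x y u} → u < L → (x , y) ∼ step w u → T (Subgraph.edge block x y)
  block-edge {x} {y} {u} u<L p = Equivalence.from (proj₂ block-isImage x y) (edge p)
    where
    i j : Fin (suc L)
    i = fromℕ< (s≤s (<⇒≤ u<L))
    j = fromℕ< (s≤s u<L)
    i≡ : toℕ i ≡ u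
    i≡ = toℕ-fromℕ< _
    j≡ : toℕ j ≡ suc u
    j≡ = toℕ-fromℕ< (s≤s u<L)
    next : toℕ j ≡ suc (toℕ i)
    next = trans j≡ (cong suc (sym i≡))
    edge : ∀ {x y} → (x , y) ∼ step w u →
           ∃₂ λ a b → visit a ≡ x × visit b ≡ y × T (Subgraph.edge (whole (suc L)) a b)
    edge (inj₁ (refl , refl)) = i , j , cong w i≡ , cong w j≡ , fromWitness {a? = adjacent? i j} (inj₁ next)
    edge (inj₂ (refl , refl)) = j , i , cong w j≡ , cong w i≡ , fromWitness {a? = adjacent? j i} (inj₂ next)

  edge-block : ∀ {x y} → T (Subgraph.edge block x y) → ∃ λ u → u < L × (x , y) ∼ step w u
  edge-block {x} {y} t with Equivalence.to (proj₂ block-isImage x y) t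
  ... | a , b , refl , refl , q with toWitness {a? = adjacent? a b} q
  ... | inj₁ next = toℕ a , subst (_≤ L) next (toℕ≤pred[n] b) , inj₁ (refl , cong w next)
  ... | inj₂ next = toℕ b , subst (_≤ L) next (toℕ≤pred[n] a) , inj₂ (cong w next , refl)

-- Enlarging a design

newEnds : ∀ {n s} → Pair s ⊎ (Fin s × Fin n) → (Fin n ⊎ Fin s) × (Fin n ⊎ Fin s)
newEnds = [ among inj₂ , between inj₂ inj₁ ]

among-map : ∀ {A B : Set} {s} {f : Fin s → A} (g : A → B) {e : Pair s} {x y : A} →
            among f e ∼ (x , y) → among (g ∘ f) e ∼ (g x , g y)
among-map g (inj₁ (refl , refl)) = inj₁ (refl , refl)
among-map g (inj₂ (refl , refl)) = inj₂ (refl , refl)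

least<greatest : ∀ {n} (e : Pair n) → toℕ (least e) < toℕ (greatest e)
least<greatest {suc n} (inj₁ j) = s≤s z≤n
least<greatest {suc n} (inj₂ e) = s≤s (least<greatest e)

pair-unique : ∀ {n} (e e′ : Pair n) → least e ≡ least e′ → greatest e ≡ greatest e′ → e ≡ e′
pair-unique {suc n} (inj₁ j) (inj₁ j′) p q = cong inj₁ (suc-injective q)
pair-unique {suc n} (inj₂ e) (inj₂ e′) p q = cong inj₂ (pair-unique e e′ (suc-injective p) (suc-injective q))

newEnds-injective : ∀ {n s} (e e′ : Pair s ⊎ (Fin s × Fin n)) → newEnds e ∼ newEnds e′ → e ≡ e′
newEnds-injective (inj₁ e) (inj₁ e′) (inj₁ (p , q)) =
  cong inj₁ (pair-unique e e′ (inj₂-injective p) (inj₂-injective q))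
newEnds-injective (inj₁ e) (inj₁ e′) (inj₂ (p , q)) = contradiction
  (subst₂ (λ a b → toℕ a < toℕ b) (inj₂-injective p) (inj₂-injective q) (least<greatest e))
  (<-asym (least<greatest e′))
newEnds-injective (inj₁ e) (inj₂ _) (inj₁ (_ , ()))
newEnds-injective (inj₁ e) (inj₂ _) (inj₂ (() , _))
newEnds-injective (inj₂ _) (inj₁ e) (inj₁ (_ , ()))
newEnds-injective (inj₂ _) (inj₁ e) (inj₂ (_ , ()))
newEnds-injective (inj₂ _) (inj₂ _) (inj₁ (refl , refl)) = refl
newEnds-injective (inj₂ _) (inj₂ _) (inj₂ (() , _))

newEnds-not-old : ∀ {n s} (e : Pair s ⊎ (Fin s × Fin n)) {a b} → ¬ (newEnds e ∼ (inj₁ a , inj₁ b))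
newEnds-not-old (inj₁ e) (inj₁ (() , _))
newEnds-not-old (inj₁ e) (inj₂ (() , _))
newEnds-not-old (inj₂ e) (inj₁ (() , _))
newEnds-not-old (inj₂ e) (inj₂ (() , _))

newEdge : ∀ {n s} (v w : Fin n ⊎ Fin s) → v ≢ w →
  (∃₂ λ a b → v ≡ inj₁ a × w ≡ inj₁ b) ⊎ (∃ λ e → newEnds e ∼ (v , w))
newEdge (inj₁ a) (inj₁ b) _   = inj₁ (a , b , refl , refl)
newEdge (inj₁ a) (inj₂ y) _   = inj₂ (inj₂ (y , a) , ∼-flip)
newEdge (inj₂ x) (inj₁ b) _   = inj₂ (inj₂ (x , b) , ∼-refl)
newEdge (inj₂ x) (inj₂ y) v≢w = let e , p = pair (v≢w ∘ cong inj₂) in inj₂ (inj₁ e , among-map {f = id} inj₂ {e} p)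

≈-refl : ∀ {K} {H : Subgraph K} → H ≈ H
≈-refl = (λ _ → refl) , (λ _ _ → refl)

module Enlarge {L n s : ℕ} (𝓑 : PathDesign (suc L) n) (D : Decomposition L (newEnds {n} {s})) where

  module 𝓑 = Design 𝓑

  place : Fin n ⊎ Fin s → Fin (n + s)
  place = join n s

  place-inj : Injective _≡_ _≡_ place
  place-inj {v} {w} eq = trans (sym (splitAt-join n s v)) (trans (cong (splitAt n) eq) (splitAt-join n s w))

  n≤n+s : n ≤ n + s
  n≤n+s = m≤m+n n s

  ι : Fin n → Fin (n + s)
  ι x = inject≤ x n≤n+s

  ι≡place : ∀ x → ι x ≡ place (inj₁ x)
  ι≡place x = toℕ-injective (trans (toℕ-inject≤ x n≤n+s) (sym (toℕ-↑ˡ x s)))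

  ι-inj : Injective _≡_ _≡_ ι
  ι-inj {x} {y} eq = inj₁-injective (place-inj (trans (sym (ι≡place x)) (trans eq (ι≡place y))))

  module Old (H : Subgraph (complete n)) = Image (complete n) any? ι ι-inj H

  module New (i : Index D) = PathBlock {L} (place ∘ walk D i)
    (λ u≤ v≤ eq → walk-inj D i u≤ v≤ (place-inj eq))

  enlargedBlocks : List (Subgraph (complete (n + s)))
  enlargedBlocks = map Old.image 𝓑.blocks ++ map New.block (indices D)

  data IsBlock : Subgraph (complete (n + s)) → Set where
    old : ∀ {H} → H ∈ 𝓑.blocks → IsBlock (Old.image H)
    new : ∀ i → IsBlock (New.block i)

  isBlock : ∀ {H} → H ∈ enlargedBlocks → IsBlock H
  isBlock H∈ with ∈-++⁻ (map Old.image 𝓑.blocks) H∈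
  ... | inj₁ H∈old with H , H∈𝓑 , refl ← ∈-map⁻ Old.image H∈old = old H∈𝓑
  ... | inj₂ H∈new with i , _ , refl ← ∈-map⁻ New.block H∈new = new i

  old∈ : ∀ {H} → H ∈ 𝓑.blocks → Old.image H ∈ enlargedBlocks
  old∈ H∈ = ∈-++⁺ˡ (∈-map⁺ Old.image H∈)

  new∈ : ∀ i → New.block i ∈ enlargedBlocks
  new∈ i = ∈-++⁺ʳ (map Old.image 𝓑.blocks) (∈-map⁺ New.block (enumerated D i))

  block≅ : ∀ {H} → IsBlock H → toGraph H ≅ path (suc L)
  block≅ (old H∈) = ≅-trans (Old.image≅ _) (𝓑.copies H∈)
  block≅ (new i)  = New.block≅path i

  place-∼ : ∀ {v w p} → (v , w) ∼ p → (place v , place w) ∼ (place (proj₁ p) , place (proj₂ p))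
  place-∼ (inj₁ (refl , refl)) = inj₁ (refl , refl)
  place-∼ (inj₂ (refl , refl)) = inj₂ (refl , refl)

  place-∼⁻ : ∀ {v w p} → (place v , place w) ∼ (place (proj₁ p) , place (proj₂ p)) → (v , w) ∼ p
  place-∼⁻ (inj₁ (a , b)) = inj₁ (place-inj a , place-inj b)
  place-∼⁻ (inj₂ (a , b)) = inj₂ (place-inj a , place-inj b)

  cover : ∀ v w → v ≢ w → ∃ λ H → H ∈ enlargedBlocks × T (Subgraph.edge H (place v) (place w))
  cover v w v≢w with newEdge v w v≢w
  ... | inj₁ (a , b , refl , refl) =
    let H , H∈ , t = 𝓑.covered (v≢w ∘ cong inj₁) in
    Old.image H , old∈ H∈ ,
    Equivalence.from (proj₂ (Old.isImage H) _ _) (a , b , ι≡place a , ι≡place b , t)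
  ... | inj₂ (e , p) =
    let u , u<L , q = covered D e in
    New.block (owner D e) , new∈ (owner D e) , New.block-edge (owner D e) u<L (place-∼ (∼-trans (∼-sym p) q))

  new-edge : ∀ i {v w} → T (Subgraph.edge (New.block i) (place v) (place w)) →
             ∃ λ e → owner D e ≡ i × newEnds e ∼ (v , w)
  new-edge i t =
    let u , u<L , p = New.edge-block i t
        e , o , q   = owned D i u<L
    in e , o , ∼-trans q (∼-sym (place-∼⁻ p))

  old-not-new : ∀ {H i x y} → T (Subgraph.edge (Old.image H) x y) → ¬ T (Subgraph.edge (New.block i) x y)
  old-not-new {H} {i} {x} {y} t t′ with Equivalence.to (proj₂ (Old.isImage H) x y) t
  ... | a , b , refl , refl , _ =
    let e , _ , p = new-edge i (subst₂ (λ x y → T (Subgraph.edge (New.block i) x y)) (ι≡place a) (ι≡place b) t′)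
    in newEnds-not-old e p

  new-edge-at : ∀ i {x y} → T (Subgraph.edge (New.block i) x y) →
                ∃ λ e → owner D e ≡ i × newEnds e ∼ (splitAt n x , splitAt n y)
  new-edge-at i {x} {y} t = new-edge i (subst₂ (λ x y → T (Subgraph.edge (New.block i) x y))
    (sym (join-splitAt n s x)) (sym (join-splitAt n s y)) t)

  separate : ∀ {H H′ x y} → IsBlock H → IsBlock H′ →
             T (Subgraph.edge H x y) → T (Subgraph.edge H′ x y) → H ≈ H′
  separate {x = x} {y} (old {H} H∈) (old {H′} H′∈) t t′
    with Equivalence.to (proj₂ (Old.isImage H) x y) t | Equivalence.to (proj₂ (Old.isImage H′) x y) t′
  ... | a , b , refl , refl , t₀ | a′ , b′ , p , q , t₀′
    with refl ← ι-inj p | refl ← ι-inj q =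
    isImage-cong {complete n} {complete (n + s)} ι {H} {H′} {Old.image H} {Old.image H′} (Old.isImage H) (Old.isImage H′) (𝓑.disjoint H∈ H′∈ t₀ t₀′)
  separate (old {H} _) (new i) t t′ = contradiction t′ (old-not-new {H} {i} t)
  separate (new i) (old {H} _) t t′ = contradiction t (old-not-new {H} {i} t′)
  separate {x = x} {y} (new i) (new j) t t′
    with e , refl , p ← new-edge-at i t | e′ , refl , p′ ← new-edge-at j t′
    with refl ← newEnds-injective e e′ (∼-trans p (∼-sym p′)) = ≈-refl {complete (n + s)} {New.block i}

  enlarged : PathDesign (suc L) (n + s)
  enlarged = record
    { Γ≲K      = let H , φ = 𝓑.Γ≲K in Old.image H , ≅-trans (Old.image≅ H) φ
    ; blocks   = enlargedBlocks
    ; copies   = λ H∈ → block≅ (isBlock H∈)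
    ; covered  = λ {x} {y} x≢y → subst₂ (λ x y → ∃ λ H → H ∈ enlargedBlocks × T (Subgraph.edge H x y))
                   (join-splitAt n s x) (join-splitAt n s y)
                   (cover (splitAt n x) (splitAt n y) (λ eq → x≢y (trans (sym (join-splitAt n s x)) (trans (cong place eq) (join-splitAt n s y)))))
    ; disjoint = λ H∈ H′∈ → separate (isBlock H∈) (isBlock H′∈)
    }

  enlarged-embeds : EmbeddedInto 𝓑 enlarged
  enlarged-embeds = n≤n+s , λ {H} H∈ → Old.image H , old∈ H∈ , Old.isImage H

Embeddable : ℕ → ℕ → ℕ → Set
Embeddable k n m = (𝓑 : PathDesign k n) → ∃ λ (𝓑′ : PathDesign k m) → EmbeddedInto 𝓑 𝓑′

embeddable-refl : ∀ {k n} → Embeddable k n n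
embeddable-refl {k} {n} 𝓑 = 𝓑 , ≤-refl , λ {H} H∈ → H , H∈ ,
  isImage-id {complete n} (λ x → toℕ-injective (toℕ-inject≤ x ≤-refl)) {H}

embeddable-trans : ∀ {k n m l} → Embeddable k n m → Embeddable k m l → Embeddable k n l
embeddable-trans {k} {n} {m} {l} E F 𝓑 =
  let 𝓑₁ , n≤m , e = E 𝓑
      𝓑₂ , m≤l , f = F 𝓑₁
  in 𝓑₂ , ≤-trans n≤m m≤l , λ {H} H∈ →
      let H₁ , H₁∈ , p = e H∈
          H₂ , H₂∈ , q = f H₁∈
      in H₂ , H₂∈ , isImage-trans {complete n} {complete m} {complete l}
           (λ x → inject≤-idempotent x n≤m m≤l (≤-trans n≤m m≤l)) {H} {H₁} {H₂} p q

enlarge : ∀ {L n s} → Decomposition L (newEnds {n} {s}) → Embeddable (suc L) n (n + s)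
enlarge D 𝓑 = Enlarge.enlarged 𝓑 D , Enlarge.enlarged-embeds 𝓑 D

to-injective : ∀ {A B : Set} (φ : A ↔ B) → Injective _≡_ _≡_ (Inverse.to φ)
to-injective φ {x} {y} eq = trans (sym (strictlyInverseʳ x)) (trans (cong from eq) (strictlyInverseʳ y))
  where open Inverse φ

with-length : ∀ {L L′} {V E : Set} {ends : E → V × V} → L ≡ L′ → Decomposition L ends → Decomposition L′ ends
with-length refl D = D

transpose : ∀ {L} {V X Y : Set} {f : X → V} {g : Y → V} →
            Decomposition L (between f g) → Decomposition L (between g f)
transpose = relabel (mk↔ₛ′ (λ { (x , y) → y , x }) (λ { (y , x) → x , y }) (λ _ → refl) (λ _ → refl)) (λ _ → ∼-flip)

copies : ∀ {L q} {V X Y : Set} {f : X → V} (g : Fin q → Y → V) →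
         (∀ a → Decomposition L (between f (g a))) → Decomposition L (between f (uncurry g))
copies g D = relabel
  (mk↔ₛ′ (λ { (a , x , y) → x , a , y }) (λ { (x , a , y) → a , x , y }) (λ _ → refl) (λ _ → refl))
  (λ _ → ∼-refl) (⋃ D)

cone : {V X Y : Set} {s : ℕ} → (Fin s → V) → (Y → V) → Pair s ⊎ (Fin s × Y) → V × V
cone f g = [ among f , between f g ]

infixl 4 _▹_

_▹_ : ∀ {L s} {V Y Z : Set} {f : Fin s → V} {g : Y → V} {h : Z → V} →
      Decomposition L (cone {X = Fin s} f g) → Decomposition L (between f h) →
      Decomposition L (cone {X = Fin s} f [ g , h ])
A ▹ B = relabel
  (mk↔ₛ′
    (λ { (inj₁ (inj₁ e)) → inj₁ e ; (inj₁ (inj₂ (x , y))) → inj₂ (x , inj₁ y) ; (inj₂ (x , z)) → inj₂ (x , inj₂ z) })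
    (λ { (inj₁ e) → inj₁ (inj₁ e) ; (inj₂ (x , inj₁ y)) → inj₁ (inj₂ (x , y)) ; (inj₂ (x , inj₂ z)) → inj₂ (x , z) })
    (λ { (inj₁ e) → refl ; (inj₂ (x , inj₁ y)) → refl ; (inj₂ (x , inj₂ z)) → refl })
    (λ { (inj₁ (inj₁ e)) → refl ; (inj₁ (inj₂ (x , y))) → refl ; (inj₂ (x , z)) → refl }))
  (λ { (inj₁ (inj₁ e)) → ∼-refl ; (inj₁ (inj₂ (x , y))) → ∼-refl ; (inj₂ (x , z)) → ∼-refl })
  (A ∪ B)

cone-relabel : ∀ {L s} {V Y Z : Set} {f : Fin s → V} {g : Y → V} {h : Z → V} (φ : Y ↔ Z) →
               (∀ y → h (Inverse.to φ y) ≡ g y) →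
               Decomposition L (cone {X = Fin s} f g) → Decomposition L (cone {X = Fin s} f h)
cone-relabel {f = f} φ eq = relabel (↔-refl ⊎-↔ (↔-refl ×-↔ φ))
  (λ { (inj₁ e) → ∼-refl ; (inj₂ (x , y)) → inj₁ (refl , eq y) })

infixr 5 _∷ᶠ_

_∷ᶠ_ : {V : Set} {s : ℕ} → V → (Fin s → V) → Fin (suc s) → V
(y ∷ᶠ f) zero    = y
(y ∷ᶠ f) (suc x) = f x

∷ᶠ-injective : ∀ {V : Set} {s} {y : V} {f : Fin s → V} → (∀ {x} → y ≢ f x) → Injective _≡_ _≡_ f →
               Injective _≡_ _≡_ (y ∷ᶠ f)
∷ᶠ-injective y≢f f-inj {zero}  {zero}  _  = refl
∷ᶠ-injective y≢f f-inj {zero}  {suc x} eq = contradiction eq y≢f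
∷ᶠ-injective y≢f f-inj {suc x} {zero}  eq = contradiction (sym eq) y≢f
∷ᶠ-injective y≢f f-inj {suc x} {suc z} eq = cong suc (f-inj eq)

apex : ∀ {L s} {V : Set} {y : V} {f : Fin s → V} →
       Decomposition L (among (y ∷ᶠ f)) → Decomposition L (cone {X = Fin s} f (λ (_ : Fin 1) → y))
apex = relabel
  (mk↔ₛ′
    (λ { (inj₁ x) → inj₂ (x , zero) ; (inj₂ e) → inj₁ e })
    (λ { (inj₁ e) → inj₂ e ; (inj₂ (x , zero)) → inj₁ x })
    (λ { (inj₁ e) → refl ; (inj₂ (x , zero)) → refl })
    (λ { (inj₁ x) → refl ; (inj₂ e) → refl }))
  (λ { (inj₁ x) → ∼-flip ; (inj₂ e) → ∼-refl })

complete-paths : ∀ {V : Set} {m c} → m ≡ suc c + suc c → (f : Fin m → V) → Injective _≡_ _≡_ f →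
                 Decomposition (suc (c + c)) (among f)
complete-paths refl f f-inj = Zigzag.zigzag f f-inj

square : ∀ {V : Set} {r} (f g : Fin (suc (r + r)) → V) → Injective _≡_ _≡_ f → Injective _≡_ _≡_ g →
         Disjoint f g → Decomposition (suc (r + r)) (between f g)
square {r = r} f g f-inj g-inj f≢g = Square.square {r = r} f g f-inj g-inj f≢g

module Grid {V : Set} {c r : ℕ} (ζ₁ ζ₂ : V) (col : Fin (suc c) ⊎ Fin (suc c) → V) (row : Fin r ⊎ Fin r → V)
  (col-inj : Injective _≡_ _≡_ col) (row-inj : Injective _≡_ _≡_ row) (col≢row : Disjoint col row)
  (ζ₁≢col : ∀ {y} → ζ₁ ≢ col y) (ζ₂≢col : ∀ {y} → ζ₂ ≢ col y)
  (ζ₁≢row : ∀ {t} → ζ₁ ≢ row t) (ζ₂≢row : ∀ {t} → ζ₂ ≢ row t) (r≤ : r ≤ suc (c + c)) where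

  Column : Set
  Column = Fin (suc c) ⊎ Fin (suc c)

  hub : Column → V
  hub = [ (λ _ → ζ₁) , (λ _ → ζ₂) ]

  gridEnds : Column × (⊤ ⊎ (Fin r ⊎ Fin r)) → V × V
  gridEnds (y , inj₁ _) = col y , hub y
  gridEnds (y , inj₂ t) = col y , row t

  module First = Strip ζ₁ col (row ∘ inj₁) col-inj (λ eq → inj₁-injective (row-inj eq)) col≢row ζ₁≢col ζ₁≢row r≤
  module Second = Strip ζ₂ (col ∘ swap) (row ∘ inj₂)
    (λ {x} {y} eq → trans (sym (swap-involutive x)) (trans (cong swap (col-inj eq)) (swap-involutive y)))
    (λ eq → inj₂-injective (row-inj eq)) col≢row ζ₂≢col ζ₂≢row r≤

  grid : Decomposition (suc (r + r)) gridEnds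
  grid = relabel
    (mk↔ₛ′
      (λ { (inj₁ (inj₁ i)) → inj₁ i , inj₁ tt
         ; (inj₁ (inj₂ (y , t))) → y , inj₂ (inj₁ t)
         ; (inj₂ (inj₁ i)) → inj₂ i , inj₁ tt
         ; (inj₂ (inj₂ (y , t))) → swap y , inj₂ (inj₂ t) })
      (λ { (y , inj₂ (inj₁ t)) → inj₁ (inj₂ (y , t))
         ; (y , inj₂ (inj₂ t)) → inj₂ (inj₂ (swap y , t))
         ; (inj₁ i , inj₁ tt) → inj₁ (inj₁ i)
         ; (inj₂ i , inj₁ tt) → inj₂ (inj₁ i) })
      (λ { (inj₁ i , inj₁ tt) → refl
         ; (inj₂ i , inj₁ tt) → refl
         ; (y , inj₂ (inj₁ t)) → refl
         ; (y , inj₂ (inj₂ t)) → cong (_, inj₂ (inj₂ t)) (swap-involutive y) })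
      (λ { (inj₁ (inj₁ i)) → refl
         ; (inj₁ (inj₂ (y , t))) → refl
         ; (inj₂ (inj₁ i)) → refl
         ; (inj₂ (inj₂ (y , t))) → cong (λ z → inj₂ (inj₂ (z , t))) (swap-involutive y) }))
    (λ { (inj₁ (inj₁ i)) → ∼-refl
       ; (inj₁ (inj₂ (y , t))) → ∼-refl
       ; (inj₂ (inj₁ i)) → ∼-refl
       ; (inj₂ (inj₂ (y , t))) → ∼-refl })
    (First.strip ∪ Second.strip)

hub∷ : ∀ r → (⊤ ⊎ (Fin r ⊎ Fin r)) ↔ Fin (suc (r + r))
hub∷ r = mk↔ₛ′ to from to-from from-to
  where
  to : ⊤ ⊎ (Fin r ⊎ Fin r) → Fin (suc (r + r))
  to (inj₁ _) = zero
  to (inj₂ t) = suc (join r r t)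
  from : Fin (suc (r + r)) → ⊤ ⊎ (Fin r ⊎ Fin r)
  from zero    = inj₁ tt
  from (suc x) = inj₂ (splitAt r x)
  to-from : ∀ x → to (from x) ≡ x
  to-from zero    = refl
  to-from (suc x) = cong suc (Inverse.strictlyInverseʳ (+↔⊎ {r} {r}) x)
  from-to : ∀ y → from (to y) ≡ y
  from-to (inj₁ _) = refl
  from-to (inj₂ t) = cong inj₂ (Inverse.strictlyInverseˡ (+↔⊎ {r} {r}) t)

rectangle : ∀ {V : Set} {c r} (f : Fin (suc c + suc c) → V) (g : Fin (suc (r + r)) → V) →
            Injective _≡_ _≡_ f → Injective _≡_ _≡_ g → Disjoint f g → r ≤ suc (c + c) →
            Decomposition (suc (r + r)) (between f g)
rectangle {c = c} {r} f g f-inj g-inj f≢g r≤ = relabel (↔-sym +↔⊎ ×-↔ hub∷ r)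
  (λ { (inj₁ i , inj₁ _) → ∼-refl ; (inj₂ i , inj₁ _) → ∼-refl ; (y , inj₂ t) → ∼-refl })
  (Grid.grid (g zero) (g zero) (f ∘ join _ _) (g ∘ suc ∘ join r r)
    (λ eq → to-injective (↔-sym +↔⊎) (f-inj eq))
    (λ eq → to-injective (↔-sym +↔⊎) (suc-injective (g-inj eq)))
    f≢g (f≢g ∘ sym) (f≢g ∘ sym)
    (λ eq → contradiction (g-inj eq) λ ()) (λ eq → contradiction (g-inj eq) λ ()) r≤)

-- Hamiltonian paths of the complete graph are extended to g 0 and g 1, and
-- the grid uses at each column the one of g 0 and g 1 that is still free there.
crown : ∀ {V : Set} {c} → let r = suc c in (f : Fin (r + r) → V) (g : Fin (suc (suc (r + r))) → V) →
        Injective _≡_ _≡_ f → Injective _≡_ _≡_ g → Disjoint f g →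
        Decomposition (suc (r + r)) (cone {X = Fin (r + r)} f g)
crown {V} {c} f g f-inj g-inj f≢g = relabel (↔-trans shuffle (↔-refl ⊎-↔ (↔-sym +↔⊎ ×-↔ hubs)))
  same (with-length (cong (λ L → suc (suc L)) (sym (+-suc c c))) extended ∪ grid)
  where
  r : ℕ
  r = suc c

  open Zigzag f f-inj using (zigzag; zigzag-first; zigzag-last; zigzag-visits)

  fresh : ∀ (y : Fin (suc (suc (r + r)))) i u → g y ≢ walk zigzag i u
  fresh y i u eq = f≢g (trans (sym (proj₂ (zigzag-visits i u))) (sym eq))

  open Extension zigzag (λ _ → g zero) (λ _ → g (suc zero))
    (λ i {u} _ → fresh zero i u) (λ i {u} _ → fresh (suc zero) i u)
    (λ _ eq → contradiction (g-inj eq) λ ())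

  open Grid {c = c} {r} (g (suc zero)) (g zero) (f ∘ join r r) (λ t → g (suc (suc (join r r t))))
    (λ eq → to-injective (↔-sym +↔⊎) (f-inj eq))
    (λ eq → to-injective (↔-sym +↔⊎) (suc-injective (suc-injective (g-inj eq))))
    f≢g (f≢g ∘ sym) (f≢g ∘ sym)
    (λ eq → contradiction (g-inj eq) λ ()) (λ eq → contradiction (g-inj eq) λ ()) (s≤s (m≤m+n c c))

  hubs : (⊤ ⊎ (⊤ ⊎ (Fin r ⊎ Fin r))) ↔ Fin (suc (suc (r + r)))
  hubs = mk↔ₛ′ to from to-from from-to
    where
    open Inverse (hub∷ r) using () renaming (to to to₁; from to from₁; strictlyInverseˡ to to-from₁; strictlyInverseʳ to from-to₁)
    to : ⊤ ⊎ (⊤ ⊎ (Fin r ⊎ Fin r)) → Fin (suc (suc (r + r)))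
    to (inj₁ _) = zero
    to (inj₂ y) = suc (to₁ y)
    from : Fin (suc (suc (r + r))) → ⊤ ⊎ (⊤ ⊎ (Fin r ⊎ Fin r))
    from zero    = inj₁ tt
    from (suc x) = inj₂ (from₁ x)
    to-from : ∀ x → to (from x) ≡ x
    to-from zero    = refl
    to-from (suc x) = cong suc (to-from₁ x)
    from-to : ∀ y → from (to y) ≡ y
    from-to (inj₁ _) = refl
    from-to (inj₂ y) = cong inj₂ (from-to₁ y)

  shuffle : ((Pair (r + r) ⊎ (Fin r ⊎ Fin r)) ⊎ (Column × (⊤ ⊎ (Fin r ⊎ Fin r)))) ↔
            (Pair (r + r) ⊎ (Column × (⊤ ⊎ (⊤ ⊎ (Fin r ⊎ Fin r)))))
  shuffle = mk↔ₛ′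
    (λ { (inj₁ (inj₁ e)) → inj₁ e
       ; (inj₁ (inj₂ (inj₁ i))) → inj₂ (inj₁ i , inj₁ tt)
       ; (inj₁ (inj₂ (inj₂ i))) → inj₂ (inj₂ i , inj₂ (inj₁ tt))
       ; (inj₂ (inj₁ i , inj₁ _)) → inj₂ (inj₁ i , inj₂ (inj₁ tt))
       ; (inj₂ (inj₂ i , inj₁ _)) → inj₂ (inj₂ i , inj₁ tt)
       ; (inj₂ (y , inj₂ t)) → inj₂ (y , inj₂ (inj₂ t)) })
    (λ { (inj₁ e) → inj₁ (inj₁ e)
       ; (inj₂ (inj₁ i , inj₁ _)) → inj₁ (inj₂ (inj₁ i))
       ; (inj₂ (inj₂ i , inj₂ (inj₁ _))) → inj₁ (inj₂ (inj₂ i))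
       ; (inj₂ (inj₁ i , inj₂ (inj₁ _))) → inj₂ (inj₁ i , inj₁ tt)
       ; (inj₂ (inj₂ i , inj₁ _)) → inj₂ (inj₂ i , inj₁ tt)
       ; (inj₂ (y , inj₂ (inj₂ t))) → inj₂ (y , inj₂ t) })
    (λ { (inj₁ e) → refl
       ; (inj₂ (inj₁ i , inj₁ _)) → refl
       ; (inj₂ (inj₂ i , inj₂ (inj₁ _))) → refl
       ; (inj₂ (inj₁ i , inj₂ (inj₁ _))) → refl
       ; (inj₂ (inj₂ i , inj₁ _)) → refl
       ; (inj₂ (inj₁ i , inj₂ (inj₂ t))) → refl
       ; (inj₂ (inj₂ i , inj₂ (inj₂ t))) → refl })
    (λ { (inj₁ (inj₁ e)) → refl
       ; (inj₁ (inj₂ (inj₁ i))) → refl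
       ; (inj₁ (inj₂ (inj₂ i))) → refl
       ; (inj₂ (inj₁ i , inj₁ _)) → refl
       ; (inj₂ (inj₂ i , inj₁ _)) → refl
       ; (inj₂ (inj₁ i , inj₂ t)) → refl
       ; (inj₂ (inj₂ i , inj₂ t)) → refl })

  same : ∀ e → cone {X = Fin (r + r)} f g (Inverse.to (↔-trans shuffle (↔-refl ⊎-↔ (↔-sym +↔⊎ ×-↔ hubs))) e) ∼
               [ extendedEnds , gridEnds ] e
  same (inj₁ (inj₁ e))        = ∼-refl
  same (inj₁ (inj₂ (inj₁ i))) = inj₁ (sym (zigzag-first i) , refl)
  same (inj₁ (inj₂ (inj₂ i))) = inj₁ (sym (zigzag-last i) , refl)
  same (inj₂ (inj₁ i , inj₁ _)) = ∼-refl
  same (inj₂ (inj₂ i , inj₁ _)) = ∼-refl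
  same (inj₂ (inj₁ i , inj₂ t)) = ∼-refl
  same (inj₂ (inj₂ i , inj₂ t)) = ∼-refl

-- Steps between admissible orders

-- Steps are named after the residues modulo d of the old and the new order.
module Steps (r : ℕ) where

  d : ℕ
  d = suc (r + r)

  module _ {n s : ℕ} {Y : Set} (φ : Y ↔ Fin n) where

    onto : Y → Fin n ⊎ Fin s
    onto y = inj₁ (Inverse.to φ y)

    onto-inj : Injective _≡_ _≡_ onto
    onto-inj eq = to-injective φ (inj₁-injective eq)

  module _ {q : ℕ} where

    row-inj : ∀ {V : Set} {g : Fin q × Fin d → V} → Injective _≡_ _≡_ g → ∀ a → Injective _≡_ _≡_ (λ t → g (a , t))
    row-inj g-inj a eq = cong proj₂ (g-inj eq)

    squares : ∀ {V : Set} (f : Fin d → V) (g : Fin q × Fin d → V) →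
              Injective _≡_ _≡_ f → Injective _≡_ _≡_ g → Disjoint f g → Decomposition d (between f g)
    squares f g f-inj g-inj f≢g =
      copies (λ a t → g (a , t)) λ a → square {r = r} f (λ t → g (a , t)) f-inj (row-inj g-inj a) f≢g

    rectangles : ∀ {V : Set} {c} (f : Fin (suc c + suc c) → V) (g : Fin q × Fin d → V) →
                 Injective _≡_ _≡_ f → Injective _≡_ _≡_ g → Disjoint f g → r ≤ suc (c + c) →
                 Decomposition d (between f g)
    rectangles {c = c} f g f-inj g-inj f≢g r≤ =
      copies (λ a t → g (a , t)) λ a → rectangle {c = c} {r} f (λ t → g (a , t)) f-inj (row-inj g-inj a) f≢g r≤

  Fin-+* : ∀ m {q} → (Fin m ⊎ (Fin q × Fin d)) ↔ Fin (m + q * d)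
  Fin-+* m = ↔-trans (↔-refl ⊎-↔ ↔-sym *↔×) (↔-sym +↔⊎)

  one-to-one : ∀ q → Embeddable (suc d) (1 + q * d) (1 + q * d + d)
  one-to-one q = enlarge (cone-relabel φ (λ { (inj₁ zero) → refl ; (inj₂ _) → refl })
    (apex (complete-paths (cong suc (sym (+-suc r r))) (inj₁ zero ∷ᶠ inj₂) (∷ᶠ-injective (λ ()) inj₂-injective)) ▹
     squares inj₂ (onto φ ∘ inj₂) inj₂-injective (λ eq → inj₂-injective (onto-inj φ eq)) (λ ())))
    where
    φ : (Fin 1 ⊎ (Fin q × Fin d)) ↔ Fin (1 + q * d)
    φ = Fin-+* 1

  zero-to-zero : ∀ {c} → r ≡ suc c → ∀ q → Embeddable (suc d) (suc q * d) (suc q * d + d)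
  zero-to-zero {c} refl q = enlarge (cone-relabel φ
    (λ { (inj₁ (inj₁ zero)) → refl ; (inj₁ (inj₂ _)) → refl ; (inj₂ _) → refl })
    (apex (complete-paths {c = suc c} (cong suc (sym (+-suc r r))) (inj₁ zero ∷ᶠ inj₂) (∷ᶠ-injective (λ ()) inj₂-injective)) ▹
     transpose (rectangle {c = c} {r} (onto φ ∘ inj₁ ∘ inj₂) inj₂
       (λ eq → inj₂-injective (inj₁-injective (onto-inj φ eq))) inj₂-injective (λ ()) (s≤s (m≤m+n c c))) ▹
     squares inj₂ (onto φ ∘ inj₂) inj₂-injective (λ eq → inj₂-injective (onto-inj φ eq)) (λ ())))
    where
    φ : ((Fin 1 ⊎ Fin (r + r)) ⊎ (Fin q × Fin d)) ↔ Fin (d + q * d)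
    φ = ↔-trans (↔-sym +↔⊎ ⊎-↔ ↔-refl) (Fin-+* d)

  zero-to-one : ∀ q → Embeddable (suc d) (q * d) (q * d + (suc r + suc r))
  zero-to-one q = enlarge
    (complete-paths refl inj₂ inj₂-injective ∪
     relabel (↔-refl ×-↔ ↔-sym (*↔× {q} {d})) (λ _ → ∼-refl)
       (rectangles {c = r} inj₂ (onto (↔-sym (*↔× {q} {d}))) inj₂-injective (onto-inj (↔-sym (*↔× {q} {d}))) (λ ()) (≤-trans (m≤m+n r r) (n≤1+n _))))

  one-to-zero : ∀ {c} → r ≡ suc c → ∀ q → Embeddable (suc d) (1 + suc q * d) (1 + suc q * d + (r + r))
  one-to-zero {c} refl q = enlarge (cone-relabel φ (λ { (inj₁ _) → refl ; (inj₂ _) → refl })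
    (crown {c = c} inj₂ (onto φ ∘ inj₁) inj₂-injective (λ eq → inj₁-injective (onto-inj φ eq)) (λ ()) ▹
     rectangles {c = c} inj₂ (onto φ ∘ inj₂) inj₂-injective (λ eq → inj₂-injective (onto-inj φ eq)) (λ ()) (s≤s (m≤m+n c c))))
    where
    φ : (Fin (suc d) ⊎ (Fin q × Fin d)) ↔ Fin (suc d + q * d)
    φ = Fin-+* (suc d)

  zero-to-zero* : ∀ {c} → r ≡ suc c → ∀ q j → Embeddable (suc d) (suc q * d) (suc (j + q) * d)
  zero-to-zero* r≡ q zero    = embeddable-refl
  zero-to-zero* r≡ q (suc j) = embeddable-trans {m = suc (j + q) * d} (zero-to-zero* r≡ q j)
    (subst (Embeddable (suc d) (suc (j + q) * d)) (+-comm (suc (j + q) * d) d) (zero-to-zero r≡ (j + q)))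

  one-to-one* : ∀ q j → Embeddable (suc d) (1 + q * d) (1 + (j + q) * d)
  one-to-one* q zero    = embeddable-refl
  one-to-one* q (suc j) = embeddable-trans {m = 1 + (j + q) * d} (one-to-one* q j)
    (subst (Embeddable (suc d) (1 + (j + q) * d)) (cong suc (+-comm ((j + q) * d) d)) (one-to-one (j + q)))

Residue : ℕ → ℕ → Set
Residue d n = (n ≡ 0 [mod d ]) ⊎ (n ≡ 1 [mod d ])

data Order (d : ℕ) : ℕ → Set where
  zeroʳ : ∀ q → Order d (q * d)
  oneʳ  : ∀ q → Order d (1 + q * d)

order : ∀ {d n} → 1 ≤ n → Residue d n → Order d n
order {d} {suc n} _ (inj₁ (divides q eq)) = subst (Order d) (sym eq) (zeroʳ q)
order {d} {suc n} _ (inj₂ (divides q eq)) =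
  subst (Order d ∘ suc) (sym (trans (sym (∣-∣-identityʳ n)) eq)) (oneʳ q)

path-length≤ : ∀ {k n} → path k ≲ complete n → k ≤ n
path-length≤ {k} {n} (H , φ) = injective⇒≤ {f = λ i → proj₁ (from i)} λ {i} {j} eq →
  trans (sym (strictlyInverseˡ i)) (trans (cong to (same eq)) (strictlyInverseˡ j))
  where
  open Inverse (_≅_.bijection φ)
  same : ∀ {u v : Σ (Fin n) (λ x → T (Subgraph.vertex H x))} → proj₁ u ≡ proj₁ v → u ≡ v
  same {x , s} {.x , t} refl = cong (x ,_) (T-irrelevant {Subgraph.vertex H x} s t)

<⇒suc-+ : ∀ {p q} → p < q → ∃ λ j → q ≡ suc (j + p)
<⇒suc-+ {p} p<q with j , refl ← m≤n⇒∃[o]m+o≡n p<q = j , cong suc (+-comm p j)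

embeddable : ∀ r {n m} → Order (suc (r + r)) n → Order (suc (r + r)) m → 2 ≤ n → n + 1 < m →
             Embeddable (suc (suc (r + r))) n m
embeddable zero {suc n} {suc m} _ _ _ n<m with j , refl ← <⇒suc-+ {n} {m} (≤-pred (≤-trans (s≤s (m≤m+n (suc n) 1)) n<m)) =
  subst₂ (Embeddable 2) (cong suc (*-identityʳ n)) (cong suc (*-identityʳ (suc (j + n)))) (Steps.one-to-one* 0 n (suc j))
embeddable (suc c) = by-order
  where
  r : ℕ
  r = suc c

  open Steps r

  by-order : ∀ {n m} → Order d n → Order d m → 2 ≤ n → n + 1 < m → Embeddable (suc d) n m
  by-order (zeroʳ (suc q)) (zeroʳ q′) _ n<m
    with j , refl ← <⇒suc-+ (*-cancelʳ-< d (suc q) q′ (≤-trans (s≤s (m≤m+n (suc q * d) 1)) n<m)) =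
    subst (Embeddable (suc d) (suc q * d)) (cong (λ z → suc z * d) (sym (+-suc j q)))
      (zero-to-zero* refl q (suc j))
  by-order (zeroʳ (suc q)) (oneʳ q′) _ n<m
    with j , refl ← <⇒suc-+ (*-cancelʳ-< d (suc q) q′ (≤-pred (subst (_< 1 + q′ * d) (+-comm (suc q * d) 1) n<m))) =
    embeddable-trans {m = suc (j + q) * d} (zero-to-zero* refl q j)
      (subst (Embeddable (suc d) (suc (j + q) * d)) (trans (total (suc (j + q) * d) r) (cong (λ z → 1 + suc z * d) (sym (+-suc j q))))
        (zero-to-one (suc (j + q))))
    where
    total : ∀ x r → x + (suc r + suc r) ≡ 1 + (suc (r + r) + x)
    total = solve-∀
  by-order (oneʳ (suc q)) (zeroʳ q′) _ n<m
    with j , refl ← <⇒suc-+ (*-cancelʳ-< d (suc q) q′ (≤-trans (≤-trans (n≤1+n _) (s≤s (m≤m+n (1 + suc q * d) 1))) n<m)) =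
    embeddable-trans {m = 1 + (j + suc q) * d} (one-to-one* (suc q) j)
      (subst₂ (λ z w → Embeddable (suc d) (1 + z * d) w) (sym (+-suc j q))
        (trans (total (suc (j + q) * d) r) (cong (λ z → suc z * d) (sym (+-suc j q)))) (one-to-zero refl (j + q)))
    where
    total : ∀ x r → 1 + x + (r + r) ≡ suc (r + r) + x
    total = solve-∀
  by-order (oneʳ q) (oneʳ q′) _ n<m
    with j , refl ← <⇒suc-+ (*-cancelʳ-< d q q′ (≤-pred (≤-trans (s≤s (m≤m+n (1 + q * d) 1)) n<m))) =
    one-to-one* q (suc j)
  by-order (zeroʳ zero) _ () _
  by-order (oneʳ zero) (zeroʳ _) (s≤s ()) _

theorem3p3 : ∀ (k : ℕ) → 2 ∣ k → k ≥ 2 →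
    ∀ (n : ℕ) → (n ≡ 0 [mod k ∸ 1 ] ⊎ n ≡ 1 [mod k ∸ 1 ]) →
    ∀ (𝓑 : PathDesign k n) →
    ∀ (m : ℕ) → m > n + 1 → (m ≡ 0 [mod k ∸ 1 ] ⊎ m ≡ 1 [mod k ∸ 1 ]) →
    ∃ λ (𝓑′ : PathDesign k m) → EmbeddedInto 𝓑 𝓑′
theorem3p3 .(suc r * 2) (divides (suc r) refl) _ n n-res 𝓑 m m>n+1 m-res =
  subst (λ d → Residue d n → Residue d m → Embeddable (suc d) n m) (cong suc (double r))
    (λ n-res m-res 𝓑 → let 2≤n = ≤-trans (s≤s (s≤s z≤n)) (path-length≤ (Design.Γ≲K 𝓑)) in
      embeddable r (order (≤-trans (n≤1+n 1) 2≤n) n-res) (order (≤-trans (s≤s z≤n) m>n+1) m-res) 2≤n m>n+1 𝓑)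
    n-res m-res 𝓑
  where
  double : ∀ r → r + r ≡ r * 2
  double = solve-∀
theorem3p3 .0 (divides zero refl) ()
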